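{- Let $m\ge 1$, let $X=\{x_0,x_1,\ldots,x_m\}$, and let $\mathcal{H}_f^{\circ}$ be the algebra of rooted circle trees described in the context, with the grading by degree, the disjoint-union product, and the coproduct $\Delta$ defined there. Then $\mathcal{H}_f^{\circ}$ is a connected graded commutative unital Hopf algebra.
   Context: Fix an integer $m\ge 1$, the alphabet $X=\{x_0,x_1,\ldots,x_m\}$, and a ground field $k$ of characteristic zero. A (decorated, bicolored) rooted circle tree (rct) $c^i$ consists of a root labelled by an index $i\in\{1,\ldots,m\}$ together with a finite, possibly empty, sequence of internal vertices $v_1<v_2<\cdots<v_k$ (totally ordered clockwise starting from the root), each internal vertex decorated by a letter of $X$. Thus $c^i$ is determined by the pair $(i,\eta)$ with $\eta=x_{l_1}\cdots x_{l_k}$ the word of decorations. Internal vertices decorated by $x_0$ are called white; those decorated by $x_j$, $j\ge1$, are called black. The degree is $\mathsf{deg}(c^i)=2\,(\#\text{white vertices})+(\#\text{black vertices})+1$. Let $\mathcal{H}_f^{\circ}$ be the commutative polynomial $k$-algebra freely generated by all rcts (product = disjoint union), with unit $\mathbf{1}$ (the empty forest) of degree $0$, and degree extended additively to monomials. An admissible subset of $c^i$ is a nonempty subset $J$ of its internal vertices whose minimal element (in the vertex order) is white. Given pairwise disjoint admissible subsets $J_1,\ldots,J_k$ of $c^i$ with minimal elements $w_1<\cdots<w_k$ and indices $n_1,\ldots,n_k\in\{1,\ldots,m\}$: - $(c^i/J_1\cup\cdots\cup J_k)_{n_1\cdots n_k}$ is the rct with root label $i$ whose internal vertices are the internal vertices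 of $c^i$ not in $J_1\cup\cdots\cup J_k$ together with $w_1,\ldots,w_k$, in the induced order, where $w_a$ is now decorated by $x_{n_a}$ (hence black) and all other vertices keep their decorations; - $c^{n_a}_{|J_a}$ is the rct with root label $n_a$ whose internal vertices are the elements of $J_a\setminus\{w_a\}$, in the induced order, with their decorations. The coproduct is defined on an rct $c^i$ by $$\Delta(c^i)=c^i\otimes\mathbf{1}+\mathbf{1}\otimes c^i+\sum_{\{J_1,\ldots,J_k\}}\ \sum_{n_1,\ldots,n_k=1}^{m}(c^i/J_1\cup\cdots\cup J_k)_{n_1\cdots n_k}\otimes c^{n_1}_{|J_1}\cdots c^{n_k}_{|J_k},$$ where the first sum runs over all nonempty sets $\{J_1,\ldots,J_k\}$ of pairwise disjoint admissible subsets of $c^i$ (an "admissible extraction"); $\Delta$ is extended to $\mathcal{H}_f^{\circ}$ as an algebra morphism with $\Delta(\mathbf{1})=\mathbf{1}\otimes\mathbf{1}$, and the counit sends $\mathbf{1}\mapsto1$ and every rct to $0$. -}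

module Defs where

open import Level using (Level; _⊔_) renaming (suc to lsuc)
open import Algebra.Bundles using (CommutativeRing)
open import Algebra.Structures using (IsCommutativeRing)
open import Data.Nat using (ℕ; zero; suc; _+_; _≡ᵇ_; _≤ᵇ_)
open import Data.Fin using (Fin) renaming (zero to fzero; suc to fsuc)
open import Data.Fin.Properties using () renaming (_≟_ to _≟F_)
open import Data.List using (List; []; _∷_; _++_; map; concatMap; foldr; upTo; allFin; length; zip; zipWith; filter)
open import Data.Bool.ListAction using (all; any)
open import Data.List.Relation.Unary.All using (All)
open import Data.Bool using (Bool; true; false; _∧_; _∨_; not; if_then_else_)
open import Data.Maybe using (Maybe; just; nothing)
open import Data.Product using (Σ; _×_; _,_)
open import Relation.Nullary using (¬_)
open import Relation.Nullary.Decidable using (⌊_⌋)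
open import Relation.Binary.PropositionalEquality using (_≡_)

natK : ∀ {c ℓ} (R : CommutativeRing c ℓ) → ℕ → CommutativeRing.Carrier R
natK R zero    = CommutativeRing.0# R
natK R (suc n) = CommutativeRing._+_ R (CommutativeRing.1# R) (natK R n)

record CharZeroField (c ℓ : Level) : Set (lsuc (c ⊔ ℓ)) where
  field
    commRing : CommutativeRing c ℓ
  open CommutativeRing commRing
  field
    1≉0      : ¬ (1# ≈ 0#)
    inverse  : ∀ x → ¬ (x ≈ 0#) → Σ Carrier λ y → (x * y) ≈ 1#
    charZero : ∀ n → natK commRing n ≈ 0# → n ≡ 0

module RCTHopf {c ℓ : Level} (F : CharZeroField c ℓ) (m : ℕ) where

  open CharZeroField F using (commRing)
  open CommutativeRing commRing renaming
    (Carrier to K; _≈_ to _≈K_; _+_ to _+K_; _*_ to _*K_; -_ to -K_)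

  -- letter x_j is represented by j : Fin (suc m); x₀ = fzero is white
  Letter : Set
  Letter = Fin (suc m)

  -- a rooted circle tree c^i: root index i ∈ {1..m} represented by
  -- i-1 : Fin m, and the word of decorations of v₁ < ... < v_k
  record RCT : Set where
    constructor rct
    field
      root : Fin m
      word : List Letter

  isWhite : Letter → Bool
  isWhite fzero    = true
  isWhite (fsuc _) = false

  black : Fin m → Letter
  black n = fsuc n

  degLetter : Letter → ℕ
  degLetter fzero    = 2
  degLetter (fsuc _) = 1

  degRCT : RCT → ℕ
  degRCT (rct i η) = foldr (λ x n → degLetter x + n) 1 η

  -- monomials of the free commutative algebra (forests); [] is 𝟏
  Mono : Set
  Mono = List RCT

  degMono : Mono → ℕ
  degMono = foldr (λ t n → degRCT t + n) 0

  eqLetter : Letter → Letter → Bool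
  eqLetter x y = ⌊ x ≟F y ⌋

  eqWord : List Letter → List Letter → Bool
  eqWord []       []       = true
  eqWord (x ∷ xs) (y ∷ ys) = eqLetter x y ∧ eqWord xs ys
  eqWord _        _        = false

  eqRCT : RCT → RCT → Bool
  eqRCT (rct i η) (rct j θ) = ⌊ i ≟F j ⌋ ∧ eqWord η θ

  count : RCT → Mono → ℕ
  count t = foldr (λ u n → if eqRCT t u then suc n else n) 0

  -- M and N are equal as multisets (monomials commute)
  eqMono : Mono → Mono → Bool
  eqMono M N = all (λ t → count t M ≡ᵇ count t N) (M ++ N)

  module FreeMod (B : Set) (eqB : B → B → Bool) where
    Lin : Set c
    Lin = List (K × B)

    coeff : Lin → B → K
    coeff []            b = 0#
    coeff ((k , b′) ∷ p) b = if eqB b′ b then k +K coeff p b else coeff p b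

    _≈L_ : Lin → Lin → Set ℓ
    p ≈L q = ∀ b → coeff p b ≈K coeff q b

    scale : K → Lin → Lin
    scale k = map (λ { (k′ , b) → (k *K k′ , b) })

    negL : Lin → Lin
    negL = map (λ { (k , b) → (-K k , b) })

  eqMono² : Mono × Mono → Mono × Mono → Bool
  eqMono² (A , B) (A′ , B′) = eqMono A A′ ∧ eqMono B B′

  eqMono³ : Mono × Mono × Mono → Mono × Mono × Mono → Bool
  eqMono³ (A , B , C) (A′ , B′ , C′) = eqMono A A′ ∧ eqMono B B′ ∧ eqMono C C′

  module H  = FreeMod Mono eqMono
  module H² = FreeMod (Mono × Mono) eqMono²
  module H³ = FreeMod (Mono × Mono × Mono) eqMono³

  Hf : Set c
  Hf = H.Lin

  _≈_ : Hf → Hf → Set ℓ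
  _≈_ = H._≈L_

  _+H_ : Hf → Hf → Hf
  _+H_ = _++_

  0H : Hf
  0H = []

  -H_ : Hf → Hf
  -H_ = H.negL

  _*H_ : Hf → Hf → Hf
  p *H q = concatMap (λ { (a , M) → map (λ { (b , N) → (a *K b , M ++ N) }) q }) p

  1H : Hf
  1H = (1# , []) ∷ []

  _*²_ : H².Lin → H².Lin → H².Lin
  p *² q = concatMap (λ { (a , (M , M′)) → map (λ { (b , (N , N′)) → (a *K b , (M ++ N , M′ ++ N′)) }) q }) p

  1² : H².Lin
  1² = (1# , ([] , [])) ∷ []

  -- admissible extractions of a word η of length k.
  -- An extraction {J₁,…,J_r} is encoded by a labelling ℓ of the
  -- positions 0..k-1: label 0 = not extracted, label (w+1) = belongs to
  -- the J whose minimal element is position w.  Validity: whenever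
  -- position v has label w+1 then w ≤ v, position w has label w+1 and
  -- is white.  This is a bijection with sets of pairwise disjoint
  -- admissible subsets; nonempty extraction = some label ≠ 0.

  nth : {A : Set} → A → List A → ℕ → A
  nth d []       _       = d
  nth d (x ∷ xs) zero    = x
  nth d (x ∷ xs) (suc n) = nth d xs n

  enum : {A : Set} → List A → List (ℕ × A)
  enum xs = zip (upTo (length xs)) xs

  allLists : {A : Set} → List A → ℕ → List (List A)
  allLists xs zero    = [] ∷ []
  allLists xs (suc k) = concatMap (λ x → map (x ∷_) (allLists xs k)) xs

  labellings : ℕ → List (List ℕ)
  labellings k = allLists (upTo (suc k)) k

  validLab : List Letter → List ℕ → Bool
  validLab η lab = all ok (enum lab) ∧ any (λ l → not (l ≡ᵇ 0)) lab
    where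
    ok : ℕ × ℕ → Bool
    ok (v , zero)  = true
    ok (v , suc w) = (w ≤ᵇ v) ∧ (nth 0 lab w ≡ᵇ suc w) ∧ isWhite (nth fzero η w)

  extractions : List Letter → List (List ℕ)
  extractions η = filter (λ lab → validLab η lab Data.Bool.≟ true) (labellings (length η))

  mins : List ℕ → List ℕ
  mins lab = Data.List.map (λ { (v , l) → v })
               (filter (λ { (v , l) → l Data.Nat.≟ suc v }) (enum lab))

  quotWord : List (ℕ × Letter × ℕ) → List (Fin m) → List Letter
  quotWord []                        ns       = []
  quotWord ((v , x , zero) ∷ rest)    ns       = x ∷ quotWord rest ns
  quotWord ((v , x , suc w) ∷ rest)   []       = quotWord rest []
  quotWord ((v , x , suc w) ∷ rest)   (n ∷ ns) =
    if w ≡ᵇ v then black n ∷ quotWord rest ns else quotWord rest (n ∷ ns)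

  triples : List Letter → List ℕ → List (ℕ × Letter × ℕ)
  triples η lab = zipWith (λ { (v , x) l → (v , x , l) }) (enum η) lab

  subWord : List (ℕ × Letter × ℕ) → ℕ → List Letter
  subWord tr w = Data.List.map (λ { (v , x , l) → x })
    (filter (λ { (v , x , l) → ((l ≡ᵇ suc w) ∧ not (v ≡ᵇ w)) Data.Bool.≟ true }) tr)

  ΔRCTterms : RCT → List (Mono × Mono)
  ΔRCTterms (rct i η) =
      ((rct i η ∷ []) , [])
    ∷ ([] , (rct i η ∷ []))
    ∷ concatMap (λ lab →
         let tr = triples η lab
             ws = mins lab
         in map (λ ns → ( rct i (quotWord tr ns) ∷ []
                         , zipWith (λ w n → rct n (subWord tr w)) ws ns))
                (allLists (allFin m) (length ws)))
       (extractions η)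

  ΔRCT : RCT → H².Lin
  ΔRCT t = map (λ b → (1# , b)) (ΔRCTterms t)

  ΔMono : Mono → H².Lin
  ΔMono []      = 1²
  ΔMono (t ∷ M) = ΔRCT t *² ΔMono M

  Δ : Hf → H².Lin
  Δ p = concatMap (λ { (a , M) → H².scale a (ΔMono M) }) p

  εMono : Mono → K
  εMono []      = 1#
  εMono (_ ∷ _) = 0#

  ε : Hf → K
  ε = foldr (λ { (a , M) s → (a *K εMono M) +K s }) 0#

  Δ⊗id : H².Lin → H³.Lin
  Δ⊗id = concatMap (λ { (a , (M , N)) →
           map (λ { (b , (A , B)) → (a *K b , (A , B , N)) }) (ΔMono M) })

  id⊗Δ : H².Lin → H³.Lin
  id⊗Δ = concatMap (λ { (a , (M , N)) →
           map (λ { (b , (A , B)) → (a *K b , (M , A , B)) }) (ΔMono N) })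

  -- (ε ⊗ id), (id ⊗ ε) : H⊗H → H  (via K⊗H ≅ H ≅ H⊗K)
  ε⊗id : H².Lin → Hf
  ε⊗id = map (λ { (a , (M , N)) → (a *K εMono M , N) })

  id⊗ε : H².Lin → Hf
  id⊗ε = map (λ { (a , (M , N)) → (a *K εMono N , M) })

  ηε : Hf → Hf
  ηε p = (ε p , []) ∷ []

  m∘S⊗id : (Hf → Hf) → H².Lin → Hf
  m∘S⊗id S = concatMap (λ { (a , (M , N)) →
               H.scale a (S ((1# , M) ∷ []) *H ((1# , N) ∷ [])) })

  m∘id⊗S : (Hf → Hf) → H².Lin → Hf
  m∘id⊗S S = concatMap (λ { (a , (M , N)) →
               H.scale a (((1# , M) ∷ []) *H S ((1# , N) ∷ [])) })

  IsLinear : (Hf → Hf) → Set (c ⊔ ℓ)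
  IsLinear S = (∀ p q → p ≈ q → S p ≈ S q)
             × (∀ p q → S (p +H q) ≈ (S p +H S q))
             × (∀ a p → S (H.scale a p) ≈ H.scale a (S p))

  record IsConnectedGradedCommHopf : Set (c ⊔ ℓ) where
    field
      isCommRing   : IsCommutativeRing _≈_ _+H_ _*H_ -H_ 0H 1H
      scale-cong   : ∀ a b p q → a ≈K b → p ≈ q → H.scale a p ≈ H.scale b q
      scale-+ˡ     : ∀ a b p → H.scale (a +K b) p ≈ (H.scale a p +H H.scale b p)
      scale-+ʳ     : ∀ a p q → H.scale a (p +H q) ≈ (H.scale a p +H H.scale a q)
      scale-*      : ∀ a b p → H.scale (a *K b) p ≈ H.scale a (H.scale b p)
      scale-1      : ∀ p → H.scale 1# p ≈ p
      scale-*H     : ∀ a p q → H.scale a (p *H q) ≈ (H.scale a p *H q)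
      Δ-cong       : ∀ p q → p ≈ q → Δ p H².≈L Δ q
      Δ-+          : ∀ p q → Δ (p +H q) H².≈L (Δ p ++ Δ q)
      Δ-scale      : ∀ a p → Δ (H.scale a p) H².≈L H².scale a (Δ p)
      Δ-*          : ∀ p q → Δ (p *H q) H².≈L (Δ p *² Δ q)
      Δ-1          : Δ 1H H².≈L 1²
      ε-cong       : ∀ p q → p ≈ q → ε p ≈K ε q
      ε-+          : ∀ p q → ε (p +H q) ≈K (ε p +K ε q)
      ε-scale      : ∀ a p → ε (H.scale a p) ≈K (a *K ε p)
      ε-*          : ∀ p q → ε (p *H q) ≈K (ε p *K ε q)
      ε-1          : ε 1H ≈K 1#
      coassoc      : ∀ p → Δ⊗id (Δ p) H³.≈L id⊗Δ (Δ p)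
      counitˡ      : ∀ p → ε⊗id (Δ p) ≈ p
      counitʳ      : ∀ p → id⊗ε (Δ p) ≈ p
      -- grading (H_n = span of monomials of degree n)
      deg-1        : degMono [] ≡ 0
      deg-*        : ∀ M N → degMono (M ++ N) ≡ degMono M + degMono N
      Δ-graded     : ∀ M → All (λ { (a , (A , B)) → degMono A + degMono B ≡ degMono M }) (ΔMono M)
      ε-graded     : ∀ M → ¬ (degMono M ≡ 0) → εMono M ≈K 0#
      -- connected: H_0 = K·𝟏
      connected    : ∀ M → degMono M ≡ 0 → M ≡ []
      antipode     : Σ (Hf → Hf) λ S → IsLinear S
                       × (∀ p → m∘S⊗id S (Δ p) ≈ ηε p)
                       × (∀ p → m∘id⊗S S (Δ p) ≈ ηε p)

{-# OPTIONS --safe #-}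
-- A formal linear combination is determined by its pairings ∫ p φ with the functions φ
-- on monomials that are invariant under permutation, so every identity is checked
-- against such φ. Recursively in the word η = x₀ θ, the extractions whose first block
-- has its minimum at the first letter are the unshufflings of θ into a rest α and a
-- block β, followed by an extraction from α. Unshuffling is coassociative and
-- cocommutative, and it commutes with extraction because every block lies on one
-- side of a splitting; coassociativity follows by induction on the length of words.
-- The antipode S is the left convolution inverse of the identity given by recursion on
-- the degree. It is also a right inverse: in S * (id * S) = (S * id) * S = S the value
-- on a tree t is S(t) + (id * S)(t) plus terms with id * S at trees of smaller degree.
module Submission where

open import Defs
open import Level using (Level; 0ℓ)
open import Algebra.Bundles using (CommutativeMonoid; CommutativeRing)
open import Algebra.Structures using (IsCommutativeRing)
open import Data.Bool as Bool using (Bool; true; false; if_then_else_; not; _∧_; _∨_)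
open import Data.Bool.ListAction using (any; all)
open import Data.Bool.Properties using (∧-zeroʳ; ∧-identityʳ)
open import Data.Empty using (⊥-elim)
open import Data.Fin using (Fin) renaming (zero to fzero; suc to fsuc)
open import Data.Fin.Properties using () renaming (_≟_ to _≟F_)
open import Data.List using
  ( List; []; _∷_; _++_; map; concat; concatMap; filter; foldr; length; replicate
  ; zip; zipWith; upTo; applyUpTo; allFin )
open import Data.List.Properties using (++-assoc; ++-identityʳ; concatMap-cong; map-cong-local; map-upTo)
open import Data.List.Membership.Propositional using (_∈_)
open import Data.List.Membership.Propositional.Properties using (∈-∃++; ∈-++⁺ˡ; ∈-++⁺ʳ)
open import Data.List.Relation.Unary.All as All using (All; []; _∷_)
import Data.List.Relation.Unary.All.Properties as Allₚ
open import Data.List.Relation.Unary.AllPairs using (AllPairs; []; _∷_)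
open import Data.List.Relation.Unary.Any using (here; there)
open import Data.List.Relation.Binary.Permutation.Propositional as ↭
  using (_↭_; prep; swap; ↭-refl; ↭-sym; ↭-reflexive; ↭-isEquivalence)
open import Data.List.Relation.Binary.Permutation.Propositional.Properties
  using (shift; shifts; ++⁺ˡ; ++⁺ʳ; ++-comm; ↭-empty-inv)
open import Data.Nat using (ℕ; zero; suc; _≤_; _<_; _>_; z≤n; s≤s; _≡ᵇ_; _≤ᵇ_; _<ᵇ_; _≟_) renaming (_+_ to _+ℕ_)
import Data.Nat.Properties as ℕₚ
open import Data.Nat.Solver using (module +-*-Solver)
open import Data.Product using (_×_; _,_; proj₁; proj₂)
open import Data.Product.Relation.Binary.Pointwise.NonDependent using (Pointwise; ×-isEquivalence)
open import Function using (_∘_; id; case_of_)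
open import Function.Bundles using (Equivalence)
open import Function.Related.Propositional using (equivalence)
open import Function.Related.TypeIsomorphisms using (×-commutativeMonoid)
open import Relation.Binary using (IsEquivalence)
open import Relation.Binary.PropositionalEquality as ≡ using (_≡_; _≢_; cong; cong₂)
open import Relation.Nullary using (does; yes; no)
open import Relation.Nullary.Decidable using (dec-false; dec-true)
open import Relation.Unary using (Pred; Decidable)

-- The definition of the coproduct encodes an extraction as a labelling of all positions, filtered
-- by a test that looks up labels anywhere in the word. Such a list has no evident recursion, so it
-- is scanned from left to right while the minima of the blocks already opened are remembered. The
-- comparison with the recursive extraction is made for sums in an arbitrary commutative monoid
-- because it serves twice: with values in the field it gives the identities for the coproduct, and
-- with values in types under conjunction it gives the grading. The obstacle in coassociativity is a
-- white letter that survives one extraction and becomes the minimum of a block in the next. That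
-- block is cut from a quotient word, so quotient words have to be unshuffled too; this is what
-- forces the comparison of extraction with unshuffling. The two sides of an identity usually list
-- the trees of a forest in different orders, which is why invariance of the test function is
-- carried as a hypothesis.

private variable
  a p : Level
  A B : Set a

-- Unshuffling of words and sums over lists

unshuffle : List A → List (List A × List A)
unshuffle []      = ([] , []) ∷ []
unshuffle (x ∷ η) = map (λ (α , β) → x ∷ α , β) (unshuffle η)
                 ++ map (λ (α , β) → α , x ∷ β) (unshuffle η)

module ListSum {c ℓ} (CM : CommutativeMonoid c ℓ) where

  open CommutativeMonoid CM renaming (Carrier to C)
  open import Relation.Binary.Reasoning.Setoid setoid
  open import Algebra.Properties.CommutativeSemigroup commutativeSemigroup using (interchange)

  ∑ : List A → (A → C) → C
  ∑ []       f = ε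
  ∑ (x ∷ xs) f = f x ∙ ∑ xs f

  ∑-cong-All : ∀ (xs : List A) {f g : A → C} → All (λ x → f x ≈ g x) xs → ∑ xs f ≈ ∑ xs g
  ∑-cong-All []       []       = refl
  ∑-cong-All (x ∷ xs) (e ∷ es) = ∙-cong e (∑-cong-All xs es)

  ∑-cong : ∀ (xs : List A) {f g : A → C} → (∀ x → f x ≈ g x) → ∑ xs f ≈ ∑ xs g
  ∑-cong xs e = ∑-cong-All xs (All.universal e xs)

  ∑-++ : ∀ (xs ys : List A) (f : A → C) → ∑ (xs ++ ys) f ≈ ∑ xs f ∙ ∑ ys f
  ∑-++ []       ys f = sym (identityˡ _)
  ∑-++ (x ∷ xs) ys f = trans (∙-congˡ (∑-++ xs ys f)) (sym (assoc _ _ _))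

  ∑-map : ∀ (h : A → B) (xs : List A) (f : B → C) → ∑ (map h xs) f ≈ ∑ xs (f ∘ h)
  ∑-map h []       f = refl
  ∑-map h (x ∷ xs) f = ∙-congˡ (∑-map h xs f)

  ∑-concatMap : ∀ (h : A → List B) (xs : List A) (f : B → C) →
                ∑ (concatMap h xs) f ≈ ∑ xs (λ x → ∑ (h x) f)
  ∑-concatMap h []       f = refl
  ∑-concatMap h (x ∷ xs) f = trans (∑-++ (h x) _ f) (∙-congˡ (∑-concatMap h xs f))

  ∑-ε : ∀ (xs : List A) → ∑ xs (λ _ → ε) ≈ ε
  ∑-ε []       = refl
  ∑-ε (x ∷ xs) = trans (identityˡ _) (∑-ε xs)

  ∑-∙ : ∀ (xs : List A) (f g : A → C) → ∑ xs (λ x → f x ∙ g x) ≈ ∑ xs f ∙ ∑ xs g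
  ∑-∙ []       f g = sym (identityˡ _)
  ∑-∙ (x ∷ xs) f g = trans (∙-congˡ (∑-∙ xs f g)) (interchange _ _ _ _)

  ∑-swap : ∀ (xs : List A) (ys : List B) (f : A → B → C) →
           ∑ xs (λ x → ∑ ys (f x)) ≈ ∑ ys (λ y → ∑ xs (λ x → f x y))
  ∑-swap []       ys f = sym (∑-ε ys)
  ∑-swap (x ∷ xs) ys f = trans (∙-congˡ (∑-swap xs ys f)) (sym (∑-∙ ys (f x) _))

  ∑-filter : ∀ {P : Pred A p} (P? : Decidable P) xs (f : A → C) →
             ∑ (filter P? xs) f ≈ ∑ xs (λ x → if does (P? x) then f x else ε)
  ∑-filter P? []       f = refl
  ∑-filter P? (x ∷ xs) f with does (P? x)
  ... | true  = ∙-congˡ (∑-filter P? xs f)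
  ... | false = trans (∑-filter P? xs f) (sym (identityˡ _))

  ∑-unshuffle-∷ : ∀ (x : A) η (f : List A × List A → C) →
    ∑ (unshuffle (x ∷ η)) f ≈
      ∑ (unshuffle η) (λ (α , β) → f (x ∷ α , β)) ∙ ∑ (unshuffle η) (λ (α , β) → f (α , x ∷ β))
  ∑-unshuffle-∷ x η f =
    trans (∑-++ (map _ (unshuffle η)) _ f) (∙-cong (∑-map _ (unshuffle η) f) (∑-map _ (unshuffle η) f))

  ∑-unshuffle-comm : ∀ (η : List A) (f : List A → List A → C) →
    ∑ (unshuffle η) (λ (α , β) → f α β) ≈ ∑ (unshuffle η) (λ (α , β) → f β α)
  ∑-unshuffle-comm []      f = refl
  ∑-unshuffle-comm (x ∷ η) f = begin
    ∑ (unshuffle (x ∷ η)) (λ (α , β) → f α β)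
      ≈⟨ ∑-unshuffle-∷ x η _ ⟩
    ∑ (unshuffle η) (λ (α , β) → f (x ∷ α) β) ∙ ∑ (unshuffle η) (λ (α , β) → f α (x ∷ β))
      ≈⟨ ∙-cong (∑-unshuffle-comm η _) (∑-unshuffle-comm η _) ⟩
    ∑ (unshuffle η) (λ (α , β) → f (x ∷ β) α) ∙ ∑ (unshuffle η) (λ (α , β) → f β (x ∷ α))
      ≈⟨ comm _ _ ⟩
    ∑ (unshuffle η) (λ (α , β) → f β (x ∷ α)) ∙ ∑ (unshuffle η) (λ (α , β) → f (x ∷ β) α)
      ≈⟨ ∑-unshuffle-∷ x η _ ⟨
    ∑ (unshuffle (x ∷ η)) (λ (α , β) → f β α) ∎

  ∑-unshuffle-assoc : ∀ (η : List A) (f : List A → List A → List A → C) →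
    ∑ (unshuffle η) (λ (α , β) → ∑ (unshuffle α) (λ (γ , δ) → f γ δ β)) ≈
    ∑ (unshuffle η) (λ (γ , β) → ∑ (unshuffle β) (λ (δ , ζ) → f γ δ ζ))
  ∑-unshuffle-assoc []      f = refl
  ∑-unshuffle-assoc (x ∷ η) f = begin
    ∑ (unshuffle (x ∷ η)) (λ (α , β) → ∑ (unshuffle α) (λ (γ , δ) → f γ δ β))
      ≈⟨ ∑-unshuffle-∷ x η _ ⟩
    ∑ U (λ (α , β) → ∑ (unshuffle (x ∷ α)) (λ (γ , δ) → f γ δ β)) ∙ ∑ U (λ (α , β) → ∑ (unshuffle α) (λ (γ , δ) → f γ δ (x ∷ β)))
      ≈⟨ ∙-congʳ (∑-cong U λ (α , β) → ∑-unshuffle-∷ x α _) ⟩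
    ∑ U (λ (α , β) → ∑ (unshuffle α) (λ (γ , δ) → f (x ∷ γ) δ β) ∙ ∑ (unshuffle α) (λ (γ , δ) → f γ (x ∷ δ) β)) ∙ _
      ≈⟨ ∙-congʳ (∑-∙ U _ _) ⟩
    (∑ U (λ (α , β) → ∑ (unshuffle α) (λ (γ , δ) → f (x ∷ γ) δ β)) ∙ ∑ U (λ (α , β) → ∑ (unshuffle α) (λ (γ , δ) → f γ (x ∷ δ) β))) ∙ _
      ≈⟨ ∙-cong (∙-cong (∑-unshuffle-assoc η _) (∑-unshuffle-assoc η _)) (∑-unshuffle-assoc η _) ⟩
    (∑ U (λ (γ , β) → ∑ (unshuffle β) (λ (δ , ζ) → f (x ∷ γ) δ ζ)) ∙ ∑ U (λ (γ , β) → ∑ (unshuffle β) (λ (δ , ζ) → f γ (x ∷ δ) ζ))) ∙ _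
      ≈⟨ assoc _ _ _ ⟩
    _ ∙ (∑ U (λ (γ , β) → ∑ (unshuffle β) (λ (δ , ζ) → f γ (x ∷ δ) ζ)) ∙ ∑ U (λ (γ , β) → ∑ (unshuffle β) (λ (δ , ζ) → f γ δ (x ∷ ζ))))
      ≈⟨ ∙-congˡ (∑-∙ U _ _) ⟨
    _ ∙ ∑ U (λ (γ , β) → ∑ (unshuffle β) (λ (δ , ζ) → f γ (x ∷ δ) ζ) ∙ ∑ (unshuffle β) (λ (δ , ζ) → f γ δ (x ∷ ζ)))
      ≈⟨ ∙-congˡ (∑-cong U λ (γ , β) → ∑-unshuffle-∷ x β _) ⟨
    _ ∙ ∑ U (λ (γ , β) → ∑ (unshuffle (x ∷ β)) (λ (δ , ζ) → f γ δ ζ))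
      ≈⟨ ∑-unshuffle-∷ x η _ ⟨
    ∑ (unshuffle (x ∷ η)) (λ (γ , β) → ∑ (unshuffle β) (λ (δ , ζ) → f γ δ ζ)) ∎
    where U = unshuffle η

  -- Coassociativity brings the last two parts together, and cocommutativity swaps them. This covers
  -- a block that is cut off before the word is split in two sides and that belongs to the left
  -- side.
  ∑-unshuffle-exchange : ∀ (η : List A) (f : List A → List A → List A → C) →
    ∑ (unshuffle η) (λ (α , β) → ∑ (unshuffle α) (λ (γ , δ) → f γ δ β)) ≈
    ∑ (unshuffle η) (λ (α , β) → ∑ (unshuffle α) (λ (γ , δ) → f γ β δ))
  ∑-unshuffle-exchange η f = begin
    ∑ (unshuffle η) (λ (α , β) → ∑ (unshuffle α) (λ (γ , δ) → f γ δ β)) ≈⟨ ∑-unshuffle-assoc η f ⟩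
    ∑ (unshuffle η) (λ (γ , β) → ∑ (unshuffle β) (λ (δ , ζ) → f γ δ ζ)) ≈⟨ ∑-cong (unshuffle η) (λ (γ , β) → ∑-unshuffle-comm β (f γ)) ⟩
    ∑ (unshuffle η) (λ (γ , β) → ∑ (unshuffle β) (λ (δ , ζ) → f γ ζ δ)) ≈⟨ ∑-unshuffle-assoc η (λ γ δ ζ → f γ ζ δ) ⟨
    ∑ (unshuffle η) (λ (α , β) → ∑ (unshuffle α) (λ (γ , δ) → f γ β δ)) ∎

unshuffle-length : ∀ (η : List A) → All (λ (α , β) → length α +ℕ length β ≡ length η) (unshuffle η)
unshuffle-length []      = ≡.refl ∷ []
unshuffle-length (x ∷ η) = Allₚ.++⁺
  (Allₚ.map⁺ (All.map (≡.cong suc) (unshuffle-length η)))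
  (Allₚ.map⁺ (All.map (λ e → ≡.trans (ℕₚ.+-suc _ _) (≡.cong suc e)) (unshuffle-length η)))

unshuffle-≤ˡ : ∀ {n} (η : List A) → length η ≤ n → All (λ (α , β) → length α ≤ n) (unshuffle η)
unshuffle-≤ˡ η l = All.map (λ e → ℕₚ.≤-trans (ℕₚ.m≤m+n _ _) (ℕₚ.≤-trans (ℕₚ.≤-reflexive e) l)) (unshuffle-length η)

-- Extractions from words

All-concatMap⁺ : ∀ {a b p} {A : Set a} {B : Set b} {P : B → Set p} {h : A → List B} {xs} →
                 All (λ x → All P (h x)) xs → All P (concatMap h xs)
All-concatMap⁺ = Allₚ.concat⁺ ∘ Allₚ.map⁺

concatMap-cong-local : ∀ {a b} {A : Set a} {B : Set b} {g h : A → List B} {xs} →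
                       All (λ x → g x ≡ h x) xs → concatMap g xs ≡ concatMap h xs
concatMap-cong-local es = cong concat (map-cong-local es)

module Extraction {c ℓ : Level} (F : CharZeroField c ℓ) (m : ℕ) where

  open RCTHopf F m renaming (_≈_ to _≈H_; ε to εH)

  Word : Set
  Word = List Letter

  -- The pairs (q , G) in D η are the terms c^i_q ⊗ G of Δ(c^i_η) − 1 ⊗ c^i_η,
  -- the first one being c^i_η ⊗ 1. A block whose minimum is the first letter of η is
  -- given by unshuffling the remaining letters into the block and the rest.
  -- The recursion is bounded by the fuel n, of which length η units suffice.
  extract⁺ : ℕ → Word → List (Word × Mono)
  openBlock : ℕ → Letter → Word → List (Word × Mono)

  extract : ℕ → Word → List (Word × Mono)
  extract n η = (η , []) ∷ extract⁺ n η

  extract⁺ zero    η       = []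
  extract⁺ (suc n) []      = []
  extract⁺ (suc n) (x ∷ η) = map (λ (q , G) → x ∷ q , G) (extract⁺ n η) ++ openBlock n x η

  openBlock n (fsuc _) η = []
  openBlock n fzero    η =
    concatMap (λ (α , β) → concatMap (λ k → map (λ (q , G) → black k ∷ q , rct k β ∷ G)
      ((α , []) ∷ extract⁺ n α)) (allFin m)) (unshuffle η)

  D⁺ D : Word → List (Word × Mono)
  D⁺ η = extract⁺ (length η) η
  D  η = extract  (length η) η

  -- `openBlock` extracts from the subword α with the fuel of the longer word η; independence of the
  -- fuel identifies the result with `D α`.
  extract⁺-fuel : ∀ n n′ η → length η ≤ n → length η ≤ n′ → extract⁺ n η ≡ extract⁺ n′ η
  extract⁺-fuel zero    zero     η       _       _        = ≡.refl
  extract⁺-fuel zero    (suc n′) []      _       _        = ≡.refl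
  extract⁺-fuel (suc n) zero     []      _       _        = ≡.refl
  extract⁺-fuel (suc n) (suc n′) []      _       _        = ≡.refl
  extract⁺-fuel (suc n) (suc n′) (x ∷ η) (s≤s l) (s≤s l′) =
    cong₂ _++_ (cong (map _) (extract⁺-fuel n n′ η l l′)) (openBlock-fuel x)
    where
    openBlock-fuel : ∀ x → openBlock n x η ≡ openBlock n′ x η
    openBlock-fuel (fsuc _) = ≡.refl
    openBlock-fuel fzero    = concatMap-cong-local
      (All.map (λ { {α , _} (u , u′) →
                    concatMap-cong
                      (λ k → cong (λ z → map _ ((α , []) ∷ z)) (extract⁺-fuel n n′ α u u′)) (allFin m) })
               (All.zip (unshuffle-≤ˡ η l , unshuffle-≤ˡ η l′)))

  extract-fuel : ∀ n η → length η ≤ n → extract n η ≡ D η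
  extract-fuel n η l = cong ((η , []) ∷_) (extract⁺-fuel n (length η) η l ℕₚ.≤-refl)

  module Sums {a b} (CM : CommutativeMonoid a b) where
    open CommutativeMonoid CM renaming (Carrier to C)
    open ListSum CM
    open import Relation.Binary.Reasoning.Setoid setoid

    ∑-D-black : ∀ j η (f : Word × Mono → C) →
                ∑ (D (black j ∷ η)) f ≈ ∑ (D η) (λ (q , G) → f (black j ∷ q , G))
    ∑-D-black j η f = ∙-congˡ (trans (∑-++ (map _ (D⁺ η)) [] f) (trans (identityʳ _) (∑-map _ (D⁺ η) f)))

    -- The white head either stays or is the minimum of a block with remaining letters β and tree
    -- root k. The fuel is eliminated here, so that inductions can refer to `D` itself.
    ∑-D-white : ∀ η (f : Word × Mono → C) →
      ∑ (D (fzero ∷ η)) f ≈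
        ∑ (D η) (λ (q , G) → f (fzero ∷ q , G)) ∙
        ∑ (unshuffle η) (λ (α , β) → ∑ (allFin m) (λ k → ∑ (D α) (λ (q , G) → f (black k ∷ q , rct k β ∷ G))))
    ∑-D-white η f = begin
      _ ≈⟨ ∙-congˡ (∑-++ (map _ (D⁺ η)) _ f) ⟩
      _ ≈⟨ assoc _ _ _ ⟨
      _ ≈⟨ ∙-cong (∙-congˡ (∑-map _ (D⁺ η) f)) (∑-concatMap _ (unshuffle η) f) ⟩
      _ ≈⟨ ∙-congˡ (∑-cong-All (unshuffle η) (All.map (λ { {α , β} l → begin
             _ ≈⟨ ∑-concatMap _ (allFin m) f ⟩
             _ ≈⟨ ∑-cong (allFin m) (λ k → begin
               _ ≈⟨ ∑-map _ (extract (length η) α) f ⟩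
               _ ≡⟨ cong (λ z → ∑ z (λ (q , G) → f (black k ∷ q , rct k β ∷ G))) (extract-fuel (length η) α l) ⟩
               _ ∎) ⟩
             _ ∎ }) (unshuffle-≤ˡ η ℕₚ.≤-refl))) ⟩
      _ ∎

  deg : Word → ℕ
  deg = foldr (λ x n → degLetter x +ℕ n) 1

  open +-*-Solver using (solve; _:+_; _:=_; con)

  -- Each of the two parts counts a root of its own, of degree 1; hence the successor.
  unshuffle-deg : ∀ η → All (λ (α , β) → deg α +ℕ deg β ≡ suc (deg η)) (unshuffle η)
  unshuffle-deg []      = ≡.refl ∷ []
  unshuffle-deg (x ∷ η) = Allₚ.++⁺
    (Allₚ.map⁺ (All.map (λ { {α , β} e → ≡.trans (ℕₚ.+-assoc (degLetter x) (deg α) (deg β))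
        (≡.trans (cong (degLetter x +ℕ_) e) (ℕₚ.+-suc (degLetter x) (deg η))) }) (unshuffle-deg η)))
    (Allₚ.map⁺ (All.map (λ { {α , β} e → ≡.trans
        (solve 3 (λ d a b → a :+ (d :+ b) := d :+ (a :+ b)) ≡.refl (degLetter x) (deg α) (deg β))
        (≡.trans (cong (degLetter x +ℕ_) e) (ℕₚ.+-suc (degLetter x) (deg η))) }) (unshuffle-deg η)))

  -- Opening a block trades the degree 2 of its white minimum for the degree 1 of the black letter
  -- left behind and the degree 1 of the root of the new tree.
  extract⁺-deg : ∀ n η → All (λ (q , G) → deg q +ℕ degMono G ≡ deg η) (extract⁺ n η)
  extract⁺-deg zero    η       = []
  extract⁺-deg (suc n) []      = []
  extract⁺-deg (suc n) (x ∷ η) = Allₚ.++⁺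
    (Allₚ.map⁺ (All.map (λ { {q , G} e → ≡.trans (ℕₚ.+-assoc (degLetter x) (deg q) (degMono G))
                                                  (cong (degLetter x +ℕ_) e) }) (extract⁺-deg n η)))
    (openBlock-deg x)
    where
    openBlock-deg : ∀ x → All (λ (q , G) → deg q +ℕ degMono G ≡ degLetter x +ℕ deg η) (openBlock n x η)
    openBlock-deg (fsuc _) = []
    openBlock-deg fzero    = All-concatMap⁺ (All.map (λ { {α , β} e →
      All-concatMap⁺ (All.universal (λ k → Allₚ.map⁺ (All.map (λ { {q , G} e′ → ≡.trans
        (solve 3 (λ x y z → con 1 :+ x :+ (y :+ z) := con 1 :+ ((x :+ z) :+ y)) ≡.refl (deg q) (deg β) (degMono G))
        (≡.trans (cong (λ z → suc (z +ℕ deg β)) e′) (cong suc e)) })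
        (ℕₚ.+-identityʳ (deg α) ∷ extract⁺-deg n α))) (allFin m)) }) (unshuffle-deg η))

  D-deg : ∀ η → All (λ (q , G) → deg q +ℕ degMono G ≡ deg η) (D η)
  D-deg η = ℕₚ.+-identityʳ (deg η) ∷ extract⁺-deg (length η) η

  -- The empty extraction is the head of `extract` and lies outside `extract⁺`. A nonempty G makes
  -- the degree of the quotient drop and is annihilated by the counit.
  extract⁺-nonempty : ∀ n η → All (λ (q , G) → 1 ≤ length G) (extract⁺ n η)
  extract⁺-nonempty zero    η       = []
  extract⁺-nonempty (suc n) []      = []
  extract⁺-nonempty (suc n) (x ∷ η) = Allₚ.++⁺ (Allₚ.map⁺ (extract⁺-nonempty n η)) (openBlock-nonempty x)
    where
    openBlock-nonempty : ∀ x → All (λ (q , G) → 1 ≤ length G) (openBlock n x η)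
    openBlock-nonempty (fsuc _) = []
    openBlock-nonempty fzero    = All-concatMap⁺ (All.universal (λ _ → All-concatMap⁺ (All.universal (λ _ →
      Allₚ.map⁺ (All.universal (λ _ → s≤s z≤n) _)) (allFin m))) (unshuffle η))

-- Extraction and splitting of words

module BlockSplitting {c ℓ : Level} (F : CharZeroField c ℓ) (m : ℕ) {a b} (CM : CommutativeMonoid a b) where
  open RCTHopf F m renaming (_≈_ to _≈H_; ε to εH)
  open Extraction F m
  open CommutativeMonoid CM renaming (Carrier to C)
  open ListSum CM
  open Sums CM
  open import Relation.Binary.Reasoning.Setoid setoid
  open import Algebra.Properties.CommutativeSemigroup commutativeSemigroup using (interchange)

  Test : Set a
  Test = Word → Word → Mono → C

  -- `∑DU` lists the trees in the order of their minima in the word, `∑DD` lists those of the left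
  -- side before those of the right side; the two can agree only on tests that ignore this order.
  Resp : Test → Set b
  Resp f = ∀ q₁ q₂ {G G′} → G ↭ G′ → f q₁ q₂ G ≈ f q₁ q₂ G′

  -- ⟨(unshuffle ⊗ id) ∘ D, f⟩
  ∑DU : Word → Test → C
  ∑DU η f = ∑ (D η) (λ (q , G) → ∑ (unshuffle q) (λ (q₁ , q₂) → f q₁ q₂ G))

  ∑DD : Word → Word → Test → C
  ∑DD α β f = ∑ (D α) (λ (q₁ , G₁) → ∑ (D β) (λ (q₂ , G₂) → f q₁ q₂ (G₁ ++ G₂)))

  ∑UDD : Word → Test → C
  ∑UDD η f = ∑ (unshuffle η) (λ (α , β) → ∑DD α β f)

  consˡ consʳ : Letter → Test → Test
  consˡ x f q₁ q₂ G = f (x ∷ q₁) q₂ G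
  consʳ x f q₁ q₂ G = f q₁ (x ∷ q₂) G

  withTree : Fin m → Word → Test → Test
  withTree k β f q₁ q₂ G = f q₁ q₂ (rct k β ∷ G)

  ∑DU-split : ∀ x η (f : Test) →
    ∑ (D η) (λ (q , G) → ∑ (unshuffle (x ∷ q)) (λ (q₁ , q₂) → f q₁ q₂ G)) ≈ ∑DU η (consˡ x f) ∙ ∑DU η (consʳ x f)
  ∑DU-split x η f = trans (∑-cong (D η) (λ (q , G) → ∑-unshuffle-∷ x q _)) (∑-∙ (D η) _ _)

  ∑DD-whiteˡ : ∀ α β f → ∑DD (fzero ∷ α) β f ≈ ∑DD α β (consˡ fzero f) ∙
    ∑ (unshuffle α) (λ (γ , δ) → ∑ (allFin m) (λ k → ∑DD γ β (consˡ (black k) (withTree k δ f))))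
  ∑DD-whiteˡ α β f = ∑-D-white α _

  -- The tree of a block opened on the right side appears between the two forests. Invariance of f
  -- is what allows it to be moved to the front.
  ∑DD-whiteʳ : ∀ α β f → Resp f → ∑DD α (fzero ∷ β) f ≈ ∑DD α β (consʳ fzero f) ∙
    ∑ (unshuffle β) (λ (γ , δ) → ∑ (allFin m) (λ k → ∑DD α γ (consʳ (black k) (withTree k δ f))))
  ∑DD-whiteʳ α β f r = begin
    ∑DD α (fzero ∷ β) f
      ≈⟨ ∑-cong (D α) (λ (q₁ , G₁) → ∑-D-white β _) ⟩
    _ ≈⟨ ∑-∙ (D α) _ _ ⟩
    _ ≈⟨ ∙-congˡ (∑-swap (D α) (unshuffle β) _) ⟩
    _ ≈⟨ ∙-congˡ (∑-cong (unshuffle β) λ (γ , δ) → ∑-swap (D α) (allFin m) _) ⟩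
    _ ≈⟨ ∙-congˡ (∑-cong (unshuffle β) λ (γ , δ) → ∑-cong (allFin m) λ k →
           ∑-cong (D α) λ (q₁ , G₁) → ∑-cong (D γ) λ (q₂ , G₂) → r q₁ (black k ∷ q₂) (shift (rct k δ) G₁ G₂)) ⟩
    _ ∎

  -- A block goes to the side of the splitting on which its minimum lies.
  ∑DU≈∑UDD : ∀ n η → length η ≤ n → ∀ f → Resp f → ∑DU η f ≈ ∑UDD η f
  ∑DU≈∑UDD n [] _ f r = ∙-congʳ (sym (identityʳ _))
  ∑DU≈∑UDD (suc n) (fsuc j ∷ η) (s≤s l) f r = begin
    ∑DU (black j ∷ η) f
      ≈⟨ ∑-D-black j η _ ⟩
    _ ≈⟨ ∑DU-split (black j) η f ⟩
    ∑DU η (consˡ (black j) f) ∙ ∑DU η (consʳ (black j) f)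
      ≈⟨ ∙-cong (∑DU≈∑UDD n η l _ λ q₁ q₂ → r _ _) (∑DU≈∑UDD n η l _ λ q₁ q₂ → r _ _) ⟩
    ∑UDD η (consˡ (black j) f) ∙ ∑UDD η (consʳ (black j) f)
      ≈⟨ ∙-cong (∑-cong (unshuffle η) λ (α , β) → ∑-D-black j α _)
                (∑-cong (unshuffle η) λ (α , β) → ∑-cong (D α) λ (q₁ , G₁) → ∑-D-black j β _) ⟨
    _ ≈⟨ ∑-unshuffle-∷ (black j) η _ ⟨
    ∑UDD (black j ∷ η) f ∎
  ∑DU≈∑UDD (suc n) (fzero ∷ η) (s≤s l) f r = begin
    ∑DU (fzero ∷ η) f
      ≈⟨ ∑-D-white η _ ⟩
    _ ≈⟨ ∙-cong (∑DU-split fzero η f)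
                (∑-cong U λ (α , β) → ∑-cong (allFin m) λ k → ∑DU-split (black k) α (withTree k β f)) ⟩
    _ ≈⟨ ∙-cong (∙-cong (∑DU≈∑UDD n η l _ λ q₁ q₂ → r _ _) (∑DU≈∑UDD n η l _ λ q₁ q₂ → r _ _))
                (∑-cong-All U (All.map (λ { {α , β} u → ∑-cong (allFin m) λ k →
                   ∙-cong (∑DU≈∑UDD n α u _ λ q₁ q₂ G↭ → r _ _ (prep _ G↭))
                          (∑DU≈∑UDD n α u _ λ q₁ q₂ G↭ → r _ _ (prep _ G↭)) }) (unshuffle-≤ˡ η l))) ⟩
    (∑UDD η (consˡ fzero f) ∙ ∑UDD η (consʳ fzero f)) ∙ _
      ≈⟨ ∙-congˡ (trans (∑-cong U λ (α , β) → ∑-∙ (allFin m) _ _) (∑-∙ U _ _)) ⟩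
    (∑UDD η (consˡ fzero f) ∙ ∑UDD η (consʳ fzero f)) ∙ (_ ∙ _)
      -- The terms are regrouped by the side that receives the first letter, no matter whether it
      -- stays white or opens a block.
      ≈⟨ interchange _ _ _ _ ⟩
    (∑UDD η (consˡ fzero f) ∙ ∑ U (λ (α , β) → ∑ (allFin m) λ k → ∑UDD α (consˡ (black k) (withTree k β f)))) ∙
    (∑UDD η (consʳ fzero f) ∙ ∑ U (λ (α , β) → ∑ (allFin m) λ k → ∑UDD α (consʳ (black k) (withTree k β f))))
      ≈⟨ ∙-cong (∙-congˡ blocksˡ) (∙-congˡ blocksʳ) ⟩
    _ ≈⟨ ∙-cong (∑-∙ U _ _) (∑-∙ U _ _) ⟨
    _ ≈⟨ ∙-cong (∑-cong U λ (α , β) → ∑DD-whiteˡ α β f) (∑-cong U λ (α , β) → ∑DD-whiteʳ α β f r) ⟨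
    _ ≈⟨ ∑-unshuffle-∷ fzero η _ ⟨
    ∑UDD (fzero ∷ η) f ∎
    where
    U = unshuffle η
    -- The block is cut off before the separation into sides in one sum and after it in the other.
    -- For a block of the left side this exchanges two parts; for one of the right side, in
    -- `blocksʳ`, the parts keep their order and coassociativity is enough.
    blocksˡ : ∑ U (λ (α , β) → ∑ (allFin m) λ k → ∑UDD α (consˡ (black k) (withTree k β f))) ≈
              ∑ U (λ (α , β) → ∑ (unshuffle α) λ (γ , δ) → ∑ (allFin m) λ k → ∑DD γ β (consˡ (black k) (withTree k δ f)))
    blocksˡ = trans (∑-cong U λ (α , β) → ∑-swap (allFin m) (unshuffle α) _)
                    (∑-unshuffle-exchange η λ γ δ β → ∑ (allFin m) λ k → ∑DD γ δ (consˡ (black k) (withTree k β f)))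
    blocksʳ : ∑ U (λ (α , β) → ∑ (allFin m) λ k → ∑UDD α (consʳ (black k) (withTree k β f))) ≈
              ∑ U (λ (α , β) → ∑ (unshuffle β) λ (γ , δ) → ∑ (allFin m) λ k → ∑DD α γ (consʳ (black k) (withTree k δ f)))
    blocksʳ = trans (∑-cong U λ (α , β) → ∑-swap (allFin m) (unshuffle α) _)
                    (∑-unshuffle-assoc η λ γ δ β → ∑ (allFin m) λ k → ∑DD γ δ (consʳ (black k) (withTree k β f)))

-- Labellings

≡ᵇ-refl : ∀ n → (n ≡ᵇ n) ≡ true
≡ᵇ-refl n = dec-true (n ≟ n) ≡.refl

≢⇒≡ᵇ : ∀ {m n} → m ≢ n → (m ≡ᵇ n) ≡ false
≢⇒≡ᵇ {m} {n} m≢n = dec-false (m ≟ n) m≢n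

≟-does : ∀ b → does (b Bool.≟ true) ≡ b
≟-does false = ≡.refl
≟-does true  = ≡.refl

zipWith-cong-local : ∀ {a b c} {A : Set a} {B : Set b} {C : Set c} {f g : A → B → C} {xs} →
                     All (λ x → ∀ y → f x y ≡ g x y) xs → ∀ ys → zipWith f xs ys ≡ zipWith g xs ys
zipWith-cong-local []       ys       = ≡.refl
zipWith-cong-local (e ∷ es) []       = ≡.refl
zipWith-cong-local (e ∷ es) (y ∷ ys) = cong₂ _∷_ (e y) (zipWith-cong-local es ys)

elem : ℕ → List ℕ → Bool
elem w = any (w ≡ᵇ_)

module Labels {c ℓ : Level} (F : CharZeroField c ℓ) (m : ℕ) where
  open Extraction F m
  open RCTHopf F m renaming (_≈_ to _≈H_; ε to εH)

  -- Positions are absolute, so an induction over suffixes needs enumerations with an arbitrary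
  -- starting position v; `triplesFrom` and `minsFrom` have this form for the same reason.
  enumFrom : ∀ {A : Set} → ℕ → List A → List (ℕ × A)
  enumFrom v []       = []
  enumFrom v (x ∷ xs) = (v , x) ∷ enumFrom (suc v) xs

  -- `upTo` unfolds by composing its function with the successor, so the induction has to be over
  -- all f with values v + i.
  zip-applyUpTo : ∀ {A : Set} (f : ℕ → ℕ) v → (∀ i → f i ≡ v +ℕ i) →
                  ∀ (xs : List A) → zip (applyUpTo f (length xs)) xs ≡ enumFrom v xs
  zip-applyUpTo f v e []       = ≡.refl
  zip-applyUpTo f v e (x ∷ xs) = cong₂ _∷_ (cong (_, x) (≡.trans (e 0) (ℕₚ.+-identityʳ v)))
    (zip-applyUpTo (f ∘ suc) (suc v) (λ i → ≡.trans (e (suc i)) (ℕₚ.+-suc v i)) xs)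

  enum≡enumFrom : ∀ {A : Set} (xs : List A) → enum xs ≡ enumFrom 0 xs
  enum≡enumFrom = zip-applyUpTo id 0 (λ _ → ≡.refl)

  triplesFrom : ℕ → Word → List ℕ → List (ℕ × Letter × ℕ)
  triplesFrom v (x ∷ η) (l ∷ lab) = (v , x , l) ∷ triplesFrom (suc v) η lab
  triplesFrom v _       _         = []

  triples≡triplesFrom : ∀ η lab → triples η lab ≡ triplesFrom 0 η lab
  triples≡triplesFrom η lab = ≡.trans (cong (λ z → zipWith _ z lab) (enum≡enumFrom η)) (from 0 η lab)
    where
    from : ∀ v η lab → zipWith (λ { (v , x) l → (v , x , l) }) (enumFrom v η) lab ≡ triplesFrom v η lab
    from v []      lab       = ≡.refl
    from v (x ∷ η) []        = ≡.refl
    from v (x ∷ η) (l ∷ lab) = cong (_ ∷_) (from (suc v) η lab)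

  minsFrom : ℕ → List ℕ → List ℕ
  minsFrom v []        = []
  minsFrom v (l ∷ lab) = if l ≡ᵇ suc v then v ∷ minsFrom (suc v) lab else minsFrom (suc v) lab

  mins≡minsFrom : ∀ lab → mins lab ≡ minsFrom 0 lab
  mins≡minsFrom lab = ≡.trans (cong (λ z → map proj₁ (filter _ z)) (enum≡enumFrom lab)) (from 0 lab)
    where
    from : ∀ v lab → map proj₁ (filter (λ { (v , l) → l ≟ suc v }) (enumFrom v lab)) ≡ minsFrom v lab
    from v []        = ≡.refl
    from v (l ∷ lab) with l ≡ᵇ suc v
    ... | true  = cong (v ∷_) (from (suc v) lab)
    ... | false = from (suc v) lab

  minsFrom-≥ : ∀ v lab → All (v ≤_) (minsFrom v lab)
  minsFrom-≥ v []        = []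
  minsFrom-≥ v (l ∷ lab) with l ≡ᵇ suc v
  ... | true  = ℕₚ.≤-refl ∷ All.map ℕₚ.<⇒≤ (minsFrom-≥ (suc v) lab)
  ... | false = All.map ℕₚ.<⇒≤ (minsFrom-≥ (suc v) lab)

  subWord-∷ : ∀ v x l tr w → subWord ((v , x , l) ∷ tr) w ≡
              (if (l ≡ᵇ suc w) ∧ not (v ≡ᵇ w) then x ∷ subWord tr w else subWord tr w)
  subWord-∷ v x l tr w with (l ≡ᵇ suc w) ∧ not (v ≡ᵇ w)
  ... | true  = ≡.refl
  ... | false = ≡.refl

  -- The minimum of a block remains in the quotient as a black vertex and is not a vertex of the
  -- tree cut off.
  subWord-min : ∀ v x l tr → subWord ((v , x , l) ∷ tr) v ≡ subWord tr v
  subWord-min v x l tr rewrite subWord-∷ v x l tr v | ≡ᵇ-refl v | ∧-zeroʳ (l ≡ᵇ suc v) = ≡.refl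

  subWord-other : ∀ v x w tr {u} → w ≢ u → subWord ((v , x , suc w) ∷ tr) u ≡ subWord tr u
  subWord-other v x w tr {u} w≢u rewrite subWord-∷ v x (suc w) tr u | ≢⇒≡ᵇ w≢u = ≡.refl

  subWord-< : ∀ v x w tr {u} → u < v → subWord ((v , x , suc w) ∷ tr) u ≡
              (if w ≡ᵇ u then x ∷ subWord tr u else subWord tr u)
  subWord-< v x w tr {u} u<v
    rewrite subWord-∷ v x (suc w) tr u | ≢⇒≡ᵇ (ℕₚ.>⇒≢ u<v) | ∧-identityʳ (w ≡ᵇ u) = ≡.refl

  -- v is the position at which the suffix starts and O lists the minima, all less
  -- than v, of the blocks that were opened before it.
  validFrom : ℕ → List ℕ → Word → List ℕ → Bool
  validFrom v O (x ∷ η) (zero  ∷ lab) = validFrom (suc v) O η lab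
  validFrom v O (x ∷ η) (suc w ∷ lab) =
    if w ≡ᵇ v then isWhite x ∧ validFrom (suc v) (v ∷ O) η lab
              else elem w O ∧ validFrom (suc v) O η lab
  validFrom v O _       _             = true

  -- The test `ok` is local to `validLab`, so it enters through its two defining equations, which
  -- hold by computation.
  module Validity (η̂ : Word) (labels : List ℕ) (ok : ℕ × ℕ → Bool)
    (ok-zero : ∀ v → ok (v , 0) ≡ true)
    (ok-suc  : ∀ v w → ok (v , suc w) ≡ (w ≤ᵇ v) ∧ (nth 0 labels w ≡ᵇ suc w) ∧ isWhite (nth fzero η̂ w))
    where

    isMin : ℕ → Bool
    isMin w = (nth 0 labels w ≡ᵇ suc w) ∧ isWhite (nth fzero η̂ w)

    <ᵇ-suc : ∀ w v → w ≢ v → (w <ᵇ suc v) ≡ (w <ᵇ v)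
    <ᵇ-suc zero    zero    w≢v = ⊥-elim (w≢v ≡.refl)
    <ᵇ-suc zero    (suc v) w≢v = ≡.refl
    <ᵇ-suc (suc w) zero    w≢v = ≡.refl
    <ᵇ-suc (suc w) (suc v) w≢v = <ᵇ-suc w v (w≢v ∘ cong suc)

    ≤ᵇ≡<ᵇ-suc : ∀ w v → (w ≤ᵇ v) ≡ (w <ᵇ suc v)
    ≤ᵇ≡<ᵇ-suc zero    v = ≡.refl
    ≤ᵇ≡<ᵇ-suc (suc w) v = ≡.refl

    -- The invariant of the scan: for positions before v, membership in O replaces the look-up in
    -- the whole labelling and the whole word.
    Opened : ℕ → List ℕ → Set
    Opened v O = ∀ w → elem w O ≡ (w <ᵇ v) ∧ isMin w

    Opened-skip : ∀ {v} O → isMin v ≡ false → Opened v O → Opened (suc v) O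
    Opened-skip {v} O e o w with w ≟ v
    ... | yes ≡.refl rewrite o v | e = ≡.trans (∧-zeroʳ (v <ᵇ v)) (≡.sym (∧-zeroʳ (v <ᵇ suc v)))
    ... | no w≢v    rewrite <ᵇ-suc w v w≢v = o w

    Opened-open : ∀ {v} O → isMin v ≡ true → Opened v O → Opened (suc v) (v ∷ O)
    Opened-open {v} O e o w with w ≟ v
    ... | yes ≡.refl rewrite ≡ᵇ-refl v | e | dec-true (v ℕₚ.<? suc v) ℕₚ.≤-refl = ≡.refl
    ... | no w≢v    rewrite ≢⇒≡ᵇ w≢v | <ᵇ-suc w v w≢v = o w

    ok-min : ∀ v → ok (v , suc v) ≡ isMin v
    ok-min v rewrite ok-suc v v | ≤ᵇ≡<ᵇ-suc v v | dec-true (v ℕₚ.<? suc v) ℕₚ.≤-refl = ≡.refl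

    -- For a label w+1 with w different from v, the condition w ≤ v means w < v, and `Opened` turns
    -- the rest of the test into membership in O. For w = v the test asks only whether the current
    -- letter is white, and success adds v to O. The two index hypotheses place the suffix at offset
    -- v.
    all-ok≡validFrom : ∀ v O η lab → length lab ≡ length η →
      (∀ i → nth 0 lab i ≡ nth 0 labels (v +ℕ i)) → (∀ i → nth fzero η i ≡ nth fzero η̂ (v +ℕ i)) →
      Opened v O → all ok (enumFrom v lab) ≡ validFrom v O η lab
    all-ok≡validFrom v O []      []            len eˡ eʷ o = ≡.refl
    all-ok≡validFrom v O (x ∷ η) (l ∷ lab) len eˡ eʷ o = step l isMin-v
      where
      shiftIndex : ∀ {A : Set} {d : A} {y ys} zs → (∀ i → nth d (y ∷ ys) i ≡ nth d zs (v +ℕ i)) →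
              ∀ i → nth d ys i ≡ nth d zs (suc v +ℕ i)
      shiftIndex {d = d} zs e i = ≡.trans (e (suc i)) (cong (nth d zs) (ℕₚ.+-suc v i))
      isMin-v : isMin v ≡ (l ≡ᵇ suc v) ∧ isWhite x
      isMin-v = cong₂ (λ a b → (a ≡ᵇ suc v) ∧ isWhite b)
        (≡.sym (≡.trans (eˡ 0) (cong (nth 0 labels) (ℕₚ.+-identityʳ v))))
        (≡.sym (≡.trans (eʷ 0) (cong (nth fzero η̂) (ℕₚ.+-identityʳ v))))
      rest : ∀ O → Opened (suc v) O → all ok (enumFrom (suc v) lab) ≡ validFrom (suc v) O η lab
      rest O = all-ok≡validFrom (suc v) O η lab (ℕₚ.suc-injective len) (shiftIndex labels eˡ) (shiftIndex η̂ eʷ)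
      step : ∀ l → isMin v ≡ (l ≡ᵇ suc v) ∧ isWhite x →
             ok (v , l) ∧ all ok (enumFrom (suc v) lab) ≡ validFrom v O (x ∷ η) (l ∷ lab)
      step zero    h rewrite ok-zero v = rest O (Opened-skip O h o)
      step (suc w) h with w ≟ v
      ... | yes ≡.refl rewrite ≡ᵇ-refl v | ok-min v | h with isWhite x
      ...   | true  = rest (v ∷ O) (Opened-open O h o)
      ...   | false = ≡.refl
      step (suc w) h | no w≢v
        rewrite ≢⇒≡ᵇ w≢v | ok-suc v w | ≤ᵇ≡<ᵇ-suc w v | <ᵇ-suc w v w≢v | ≡.sym (o w) =
        cong (elem w O ∧_) (rest O (Opened-skip O h o))

  validLab≡ : ∀ η lab → length lab ≡ length η →
              validLab η lab ≡ validFrom 0 [] η lab ∧ any (λ l → not (l ≡ᵇ 0)) lab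
  validLab≡ η lab len = helper _ (λ _ → ≡.refl) (λ _ _ → ≡.refl)
    where
    helper : ∀ ok → (∀ v → ok (v , 0) ≡ true) →
             (∀ v w → ok (v , suc w) ≡ (w ≤ᵇ v) ∧ (nth 0 lab w ≡ᵇ suc w) ∧ isWhite (nth fzero η w)) →
             all ok (enum lab) ∧ any (λ l → not (l ≡ᵇ 0)) lab ≡ validFrom 0 [] η lab ∧ any (λ l → not (l ≡ᵇ 0)) lab
    helper ok z s = cong (_∧ _) (≡.trans (cong (all ok) (enum≡enumFrom lab))
      (Validity.all-ok≡validFrom η lab ok z s 0 [] η lab len (λ _ → ≡.refl) (λ _ → ≡.refl) (λ _ → ≡.refl)))

-- Lists of open blocks and unshuffling into several parts

∉⇒elem : ∀ {w O} → All (w ≢_) O → elem w O ≡ false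
∉⇒elem []         = ≡.refl
∉⇒elem (n ∷ ns) rewrite ≢⇒≡ᵇ n = ∉⇒elem ns

elem⇒ : ∀ {p} {P : ℕ → Set p} {w O} → All P O → elem w O ≡ true → P w
elem⇒ {w = w} {o ∷ O} (p ∷ ps) e with w ≟ o
... | yes ≡.refl = p
... | no w≢o rewrite ≢⇒≡ᵇ w≢o = elem⇒ ps e

-- The lists of subwords run parallel to O: each holds the letters that join the block whose minimum
-- stands at the same place in O.
insertAt : ∀ {A : Set} → ℕ → A → List ℕ → List (List A) → List (List A)
insertAt w₀ x (w ∷ O) (u ∷ us) = (if w₀ ≡ᵇ w then x ∷ u else u) ∷ insertAt w₀ x O us
insertAt w₀ x _       us       = us

insertAt-∉ : ∀ {A : Set} {w₀} {x : A} {O} → All (w₀ ≢_) O → ∀ us → insertAt w₀ x O us ≡ us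
insertAt-∉ []       us       = ≡.refl
insertAt-∉ (n ∷ ns) []       = ≡.refl
insertAt-∉ (n ∷ ns) (u ∷ us) rewrite ≢⇒≡ᵇ n = cong (u ∷_) (insertAt-∉ ns us)

-- One subword is split off for each label in O; the rest comes first.
unshuffles : ∀ {A : Set} → List ℕ → List A → List (List A × List (List A))
unshuffles []      η = (η , []) ∷ []
unshuffles (w ∷ O) η = concatMap (λ (η₀ , us) → map (λ (α , β) → α , β ∷ us) (unshuffle η₀)) (unshuffles O η)

module IndicatorSums {a b} (CM : CommutativeMonoid a b) where
  open CommutativeMonoid CM renaming (Carrier to C)
  open ListSum CM
  open import Relation.Binary.Reasoning.Setoid setoid

  ∑-applyUpTo-ε : ∀ {A : Set} (f : ℕ → A) n (g : A → C) → (∀ i → g (f i) ≈ ε) → ∑ (applyUpTo f n) g ≈ ε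
  ∑-applyUpTo-ε f zero    g e = refl
  ∑-applyUpTo-ε f (suc n) g e = trans (∙-cong (e 0) (∑-applyUpTo-ε (f ∘ suc) n g (e ∘ suc))) (identityˡ _)

  ∑-applyUpTo-suc : ∀ n (g : ℕ → C) → ∑ (applyUpTo suc n) g ≈ ∑ (upTo n) (g ∘ suc)
  ∑-applyUpTo-suc n g = trans (reflexive (cong (λ z → ∑ z g) (≡.sym (map-upTo suc n)))) (∑-map suc (upTo n) g)

  ∑-upTo-≡ : ∀ {v n} → v < n → (g : ℕ → C) → ∑ (upTo n) (λ w → if w ≡ᵇ v then g w else ε) ≈ g v
  ∑-upTo-≡ {zero}  {suc n} _       g = trans (∙-congˡ (∑-applyUpTo-ε suc n _ (λ _ → refl))) (identityʳ _)
  ∑-upTo-≡ {suc v} {suc n} (s≤s l) g =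
    trans (identityˡ _) (trans (∑-applyUpTo-suc n _) (∑-upTo-≡ l (g ∘ suc)))

  -- Strict decrease makes the entries of O distinct and less than n, so the indicator of membership
  -- is the sum of the indicators of the entries. A sum over all labels thereby becomes a sum over
  -- open blocks.
  ∑-upTo-elem : ∀ {n} O → AllPairs _>_ (n ∷ O) → (g : ℕ → C) →
                ∑ (upTo n) (λ w → if elem w O then g w else ε) ≈ ∑ O g
  ∑-upTo-elem {n} []      _ g = ∑-ε (upTo n)
  ∑-upTo-elem {n} (o ∷ O) ((n>o ∷ n>O) ∷ (o>O ∷ ap)) g = begin
    ∑ (upTo n) (λ w → if elem w (o ∷ O) then g w else ε)
      ≈⟨ ∑-cong (upTo n) disjoint ⟩
    ∑ (upTo n) (λ w → (if w ≡ᵇ o then g w else ε) ∙ (if elem w O then g w else ε))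
      ≈⟨ ∑-∙ (upTo n) _ _ ⟩
    _ ≈⟨ ∙-cong (∑-upTo-≡ n>o g) (∑-upTo-elem O (n>O ∷ ap) g) ⟩
    g o ∙ ∑ O g ∎
    where
    disjoint : ∀ w → (if elem w (o ∷ O) then g w else ε) ≈ (if w ≡ᵇ o then g w else ε) ∙ (if elem w O then g w else ε)
    disjoint w with w ≟ o
    ... | yes ≡.refl rewrite ≡ᵇ-refl o | ∉⇒elem (All.map ℕₚ.>⇒≢ o>O) = sym (identityʳ _)
    ... | no w≢o    rewrite ≢⇒≡ᵇ w≢o = sym (identityˡ _)

  ∑-unshuffles-open : ∀ {A : Set} w O (η : List A) (f : List A → List (List A) → C) →
    ∑ (unshuffles (w ∷ O) η) (λ (η₀ , us) → f η₀ us) ≈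
    ∑ (unshuffles O η) (λ (η₀ , us) → ∑ (unshuffle η₀) (λ (α , β) → f α (β ∷ us)))
  ∑-unshuffles-open w O η f =
    trans (∑-concatMap _ (unshuffles O η) _) (∑-cong (unshuffles O η) λ (η₀ , us) → ∑-map _ (unshuffle η₀) _)

  ∑-unshuffles-[] : ∀ {A : Set} O (f : List A → List (List A) → C) →
    ∑ (unshuffles O []) (λ (η₀ , us) → f η₀ us) ≈ f [] (map (λ _ → []) O)
  ∑-unshuffles-[] []      f = identityʳ _
  ∑-unshuffles-[] (w ∷ O) f = trans (∑-unshuffles-open w O [] f)
    (trans (∑-unshuffles-[] O λ η₀ us → ∑ (unshuffle η₀) (λ (α , β) → f α (β ∷ us))) (identityʳ _))

  -- The letter x has exactly one destination, the rest or one of the parts. Distinctness of the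
  -- entries of O ensures that `insertAt` changes a single part.
  ∑-unshuffles-∷ : ∀ {A : Set} O → AllPairs _>_ O → ∀ (x : A) η (f : List A → List (List A) → C) →
    ∑ (unshuffles O (x ∷ η)) (λ (η₀ , us) → f η₀ us) ≈
      ∑ (unshuffles O η) (λ (η₀ , us) → f (x ∷ η₀) us) ∙
      ∑ O (λ w → ∑ (unshuffles O η) (λ (η₀ , us) → f η₀ (insertAt w x O us)))
  ∑-unshuffles-∷ [] _ x η f = trans (identityʳ _) (sym (trans (identityʳ _) (identityʳ _)))
  ∑-unshuffles-∷ (w ∷ O) (w>O ∷ ap) x η f = begin
    _ ≈⟨ ∑-unshuffles-open w O (x ∷ η) f ⟩
    ∑ (unshuffles O (x ∷ η)) (λ (η₀ , us) → g η₀ us)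
      ≈⟨ ∑-unshuffles-∷ O ap x η g ⟩
    _ ≈⟨ ∙-congʳ (∑-cong (unshuffles O η) λ (η₀ , us) → ∑-unshuffle-∷ x η₀ _) ⟩
    _ ≈⟨ ∙-congʳ (∑-∙ (unshuffles O η) _ _) ⟩
    _ ≈⟨ assoc _ _ _ ⟩
    ∑ (unshuffles O η) (λ (η₀ , us) → ∑ (unshuffle η₀) (λ (α , β) → f (x ∷ α) (β ∷ us))) ∙
      (∑ (unshuffles O η) (λ (η₀ , us) → ∑ (unshuffle η₀) (λ (α , β) → f α ((x ∷ β) ∷ us))) ∙
       ∑ O (λ w′ → ∑ (unshuffles O η) (λ (η₀ , us) → ∑ (unshuffle η₀) (λ (α , β) → f α (β ∷ insertAt w′ x O us)))))
      ≈⟨ ∙-cong (∑-unshuffles-open w O η (λ η₀ us → f (x ∷ η₀) us)) (∙-cong own (∑-cong-All O (All.map other w>O))) ⟨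
    _ ∎
    where
    g : _ → _ → C
    g η₀ us = ∑ (unshuffle η₀) (λ (α , β) → f α (β ∷ us))
    own : ∑ (unshuffles (w ∷ O) η) (λ (η₀ , us) → f η₀ (insertAt w x (w ∷ O) us)) ≈
          ∑ (unshuffles O η) (λ (η₀ , us) → ∑ (unshuffle η₀) (λ (α , β) → f α ((x ∷ β) ∷ us)))
    own = trans (∑-unshuffles-open w O η _) (∑-cong (unshuffles O η) λ (η₀ , us) → ∑-cong (unshuffle η₀) λ (α , β) →
      reflexive (cong (f α) (cong₂ _∷_ (cong (λ b → if b then x ∷ β else β) (≡ᵇ-refl w))
                                       (insertAt-∉ (All.map ℕₚ.>⇒≢ w>O) us))))
    other : ∀ {w′} → w > w′ → ∑ (unshuffles (w ∷ O) η) (λ (η₀ , us) → f η₀ (insertAt w′ x (w ∷ O) us)) ≈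
          ∑ (unshuffles O η) (λ (η₀ , us) → ∑ (unshuffle η₀) (λ (α , β) → f α (β ∷ insertAt w′ x O us)))
    other {w′} w>w′ = trans (∑-unshuffles-open w O η _) (∑-cong (unshuffles O η) λ (η₀ , us) → ∑-cong (unshuffle η₀) λ (α , β) →
      reflexive (cong (λ b → f α ((if b then x ∷ β else β) ∷ insertAt w′ x O us)) (≢⇒≡ᵇ (ℕₚ.<⇒≢ w>w′))))

-- Comparison of labellings with the recursive extraction

module LabelSums {c ℓ : Level} (F : CharZeroField c ℓ) (m : ℕ) {a b} (CM : CommutativeMonoid a b) where
  open Extraction F m
  open Labels F m
  open RCTHopf F m renaming (_≈_ to _≈H_; ε to εH)
  open CommutativeMonoid CM renaming (Carrier to C)
  open ListSum CM
  open Sums CM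
  open IndicatorSums CM
  open import Relation.Binary.Reasoning.Setoid setoid

  Test : Set a
  Test = Word → List Word → Mono → C

  newTrees : List (ℕ × Letter × ℕ) → List ℕ → List (Fin m) → Mono
  newTrees tr = zipWith (λ w n → rct n (subWord tr w))

  -- η is the suffix at position v, and the blocks with minima O are already open.
  decorated : ℕ → List ℕ → Word → List ℕ → Test → C
  decorated v O η lab f = ∑ (allLists (allFin m) (length (minsFrom v lab))) λ ns →
    f (quotWord (triplesFrom v η lab) ns) (map (subWord (triplesFrom v η lab)) O)
      (newTrees (triplesFrom v η lab) (minsFrom v lab) ns)

  term : ℕ → List ℕ → Word → List ℕ → Test → C
  term v O η lab f = if validFrom v O η lab then decorated v O η lab f else ε

  -- Converts a test for the open blocks O into one for v ∷ O. The subword in front belongs to the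
  -- block of v: it becomes a tree of root k, and the vertex v itself becomes the black letter with
  -- the same index.
  openWith : Test → Test
  openWith f q []       G = ε
  openWith f q (u ∷ us) G = ∑ (allFin m) λ k → f (black k ∷ q) us (rct k u ∷ G)

  insertWith : ℕ → Letter → List ℕ → Test → Test
  insertWith w x O f q us G = f q (insertAt w x O us) G

  if-cong : ∀ b {s t : C} → s ≈ t → (if b then s else ε) ≈ (if b then t else ε)
  if-cong true  e = e
  if-cong false e = refl

  map-subWord-old : ∀ v x w tr {O} → All (v >_) O →
    map (subWord ((v , x , suc w) ∷ tr)) O ≡ insertAt w x O (map (subWord tr) O)
  map-subWord-old v x w tr []       = ≡.refl
  map-subWord-old v x w tr (l ∷ ls) = cong₂ _∷_ (subWord-< v x w tr l) (map-subWord-old v x w tr ls)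

  map-subWord-new : ∀ v x tr {O} → All (v >_) O → map (subWord ((v , x , suc v) ∷ tr)) O ≡ map (subWord tr) O
  map-subWord-new v x tr ls = map-cong-local (All.map (λ l → subWord-other v x v tr (ℕₚ.>⇒≢ l)) ls)

  -- Minima found after position v exceed w, so none of their trees contains the letter x.
  newTrees-later : ∀ v x w tr lab → w ≤ v → ∀ ns →
    newTrees ((v , x , suc w) ∷ tr) (minsFrom (suc v) lab) ns ≡ newTrees tr (minsFrom (suc v) lab) ns
  newTrees-later v x w tr lab w≤v = zipWith-cong-local
    (All.map (λ l n → cong (rct n) (subWord-other v x w tr (ℕₚ.<⇒≢ (ℕₚ.≤-trans (s≤s w≤v) l)))) (minsFrom-≥ (suc v) lab))

  quotWord-old : ∀ v x w tr → w ≢ v → ∀ ns → quotWord ((v , x , suc w) ∷ tr) ns ≡ quotWord tr ns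
  quotWord-old v x w tr w≢v []       = ≡.refl
  quotWord-old v x w tr w≢v (n ∷ ns) rewrite ≢⇒≡ᵇ w≢v = ≡.refl

  quotWord-new : ∀ v x tr k ns → quotWord ((v , x , suc v) ∷ tr) (k ∷ ns) ≡ black k ∷ quotWord tr ns
  quotWord-new v x tr k ns rewrite ≡ᵇ-refl v = ≡.refl

  validFrom-new : ∀ v O x η lab →
    validFrom v O (x ∷ η) (suc v ∷ lab) ≡ isWhite x ∧ validFrom (suc v) (v ∷ O) η lab
  validFrom-new v O x η lab rewrite ≡ᵇ-refl v = ≡.refl

  validFrom-old : ∀ v O x η w lab → w ≢ v →
    validFrom v O (x ∷ η) (suc w ∷ lab) ≡ elem w O ∧ validFrom (suc v) O η lab
  validFrom-old v O x η w lab w≢v rewrite ≢⇒≡ᵇ w≢v = ≡.refl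

  decorated-old : ∀ v O x η w lab f → All (v >_) O → v > w →
    decorated v O (x ∷ η) (suc w ∷ lab) f ≈ decorated (suc v) O η lab (insertWith w x O f)
  decorated-old v O x η w lab f v>O v>w
    rewrite ≢⇒≡ᵇ (ℕₚ.<⇒≢ v>w) | map-subWord-old v x w (triplesFrom (suc v) η lab) v>O =
    ∑-cong (allLists (allFin m) (length (minsFrom (suc v) lab))) λ ns → reflexive
      (cong₂ (λ q G → f q (insertAt w x O (map (subWord tr) O)) G)
        (quotWord-old v x w tr (ℕₚ.<⇒≢ v>w) ns) (newTrees-later v x w tr lab (ℕₚ.<⇒≤ v>w) ns))
    where tr = triplesFrom (suc v) η lab

  -- Minima are listed in increasing order, so the first root index belongs to v. The exchange of
  -- sums moves the choice of this index inside, where `openWith` makes it.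
  decorated-new : ∀ v O x η lab f → All (v >_) O →
    decorated v O (x ∷ η) (suc v ∷ lab) f ≈ decorated (suc v) (v ∷ O) η lab (openWith f)
  decorated-new v O x η lab f v>O
    rewrite ≡ᵇ-refl v | map-subWord-new v x (triplesFrom (suc v) η lab) v>O = begin
    _ ≈⟨ ∑-concatMap _ (allFin m) _ ⟩
    _ ≈⟨ ∑-cong (allFin m) (λ k → trans (∑-map _ (allLists (allFin m) (length ms)) _)
           (∑-cong (allLists (allFin m) (length ms)) λ ns → reflexive (eq k ns))) ⟩
    _ ≈⟨ ∑-swap (allFin m) (allLists (allFin m) (length ms)) _ ⟩
    _ ∎
    where
    tr = triplesFrom (suc v) η lab
    ms = minsFrom (suc v) lab
    eq : ∀ k ns → f (quotWord ((v , x , suc v) ∷ tr) (k ∷ ns)) (map (subWord tr) O)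
                    (newTrees ((v , x , suc v) ∷ tr) (v ∷ ms) (k ∷ ns))
                ≡ f (black k ∷ quotWord tr ns) (map (subWord tr) O) (rct k (subWord tr v) ∷ newTrees tr ms ns)
    eq k ns = cong₂ (λ q G → f q (map (subWord tr) O) G) (quotWord-new v x tr k ns)
      (cong₂ _∷_ (cong (rct k) (subWord-min v x (suc v) tr)) (newTrees-later v x v tr lab ℕₚ.≤-refl ns))

  ∑-label : ∀ N k (g : List ℕ → C) → ∑ (allLists (upTo (suc N)) (suc k)) g ≈
    ∑ (allLists (upTo (suc N)) k) (λ lab → g (0 ∷ lab)) ∙
    ∑ (upTo N) (λ w → ∑ (allLists (upTo (suc N)) k) (λ lab → g (suc w ∷ lab)))
  ∑-label N k g = begin
    _ ≈⟨ ∑-concatMap (λ l → map (l ∷_) (allLists (upTo (suc N)) k)) (upTo (suc N)) g ⟩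
    _ ≈⟨ ∑-cong (upTo (suc N)) (λ l → ∑-map (l ∷_) (allLists (upTo (suc N)) k) g) ⟩
    _ ≈⟨ ∙-congˡ (∑-applyUpTo-suc N _) ⟩
    _ ∎

  -- Blocks are disjoint, so the letters that join the open blocks O can be removed at the outset,
  -- and further blocks are extracted from what is left.
  ∑D : List ℕ → Word → Test → C
  ∑D O η f = ∑ (unshuffles O η) (λ (η₀ , us) → ∑ (D η₀) (λ (q , G) → f q us G))

  -- The label of the first letter decides: 0 keeps the letter, v+1 opens a block if the letter is
  -- white, w+1 with w in O joins an older block, and all other labels are invalid. The range N of
  -- the labels stays fixed while the suffix shrinks; the bound on v + length η guarantees that v+1
  -- is among the labels.
  ∑-labellings : ∀ N v O η f → AllPairs _>_ (v ∷ O) → v +ℕ length η ≤ N →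
    ∑ (allLists (upTo (suc N)) (length η)) (λ lab → term v O η lab f) ≈ ∑D O η f
  ∑-labellings N v O [] f ap l = begin
    (f [] (map (λ _ → []) O) [] ∙ ε) ∙ ε ≈⟨ identityʳ _ ⟩
    f [] (map (λ _ → []) O) [] ∙ ε       ≈⟨ ∑-unshuffles-[] O (λ η₀ us → ∑ (D η₀) (λ (q , G) → f q us G)) ⟨
    _ ∎
  ∑-labellings N v O (x ∷ η) f (v>O ∷ ap) l = begin
    _ ≈⟨ ∑-label N (length η) _ ⟩
    ∑ Ls (λ lab → term v O (x ∷ η) (0 ∷ lab) f) ∙ ∑ (upTo N) (λ w → ∑ Ls (λ lab → term v O (x ∷ η) (suc w ∷ lab) f))
      ≈⟨ ∙-cong (∑-labellings N (suc v) O η consWith (weaken v>O ∷ ap) l′)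
                (trans (∑-cong (upTo N) byLabel) (∑-upTo-elem (v ∷ O)
                  ((N>v ∷ All.map (λ v>w → ℕₚ.<-trans v>w N>v) v>O) ∷ v>O ∷ ap) labelled)) ⟩
    ∑D O η consWith ∙ (labelled v ∙ ∑ O labelled)
      ≈⟨ assoc _ _ _ ⟨
    (∑D O η consWith ∙ labelled v) ∙ ∑ O labelled
      -- Keeping x and opening a block at x together form the recursion of `D` for x followed by the
      -- rest; the sum over O accounts for the older blocks that x may join.
      ≈⟨ ∙-cong first (∑-cong-All O (All.map later v>O)) ⟩
    ∑ (unshuffles O η) (λ (η₀ , us) → ∑ (D (x ∷ η₀)) (λ (q , G) → f q us G)) ∙
      ∑ O (λ w → ∑D O η (insertWith w x O f))
      ≈⟨ ∑-unshuffles-∷ O ap x η (λ η₀ us → ∑ (D η₀) (λ (q , G) → f q us G)) ⟨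
    ∑D O (x ∷ η) f ∎
    where
    Ls = allLists (upTo (suc N)) (length η)
    consWith : Test
    consWith q us G = f (x ∷ q) us G
    l′ : suc v +ℕ length η ≤ N
    l′ = ≡.subst (_≤ N) (ℕₚ.+-suc v (length η)) l
    N>v : N > v
    N>v = ℕₚ.≤-trans (s≤s (ℕₚ.m≤m+n v (length η))) l′
    weaken : ∀ {O} → All (v >_) O → All (suc v >_) O
    weaken = All.map ℕₚ.m<n⇒m<1+n
    branch : Bool → ℕ → C
    branch b w = if b then (if isWhite x then ∑D (v ∷ O) η (openWith f) else ε) else ∑D O η (insertWith w x O f)
    labelled : ℕ → C
    labelled w = branch (w ≡ᵇ v) w
    byLabel : ∀ w → ∑ Ls (λ lab → term v O (x ∷ η) (suc w ∷ lab) f) ≈ (if elem w (v ∷ O) then labelled w else ε)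
    byLabel w with w ≟ v
    ... | yes ≡.refl = begin
      _ ≈⟨ ∑-cong Ls (λ lab → reflexive (cong (λ b → if b then decorated v O (x ∷ η) (suc v ∷ lab) f else ε)
             (validFrom-new v O x η lab))) ⟩
      _ ≈⟨ opened (isWhite x) ⟩
      _ ≡⟨ cong (λ b → if b ∨ elem v O then branch b v else ε) (≡ᵇ-refl v) ⟨
      _ ∎
      where
      opened : ∀ b → ∑ Ls (λ lab → if b ∧ validFrom (suc v) (v ∷ O) η lab then decorated v O (x ∷ η) (suc v ∷ lab) f else ε)
                   ≈ (if b then ∑D (v ∷ O) η (openWith f) else ε)
      opened false = ∑-ε Ls
      opened true  = trans
        (∑-cong Ls λ lab → if-cong (validFrom (suc v) (v ∷ O) η lab) (decorated-new v O x η lab f v>O))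
        (∑-labellings N (suc v) (v ∷ O) η (openWith f) ((ℕₚ.≤-refl ∷ weaken v>O) ∷ v>O ∷ ap) l′)
    ... | no w≢v = begin
      _ ≈⟨ ∑-cong Ls (λ lab → reflexive (cong (λ b → if b then decorated v O (x ∷ η) (suc w ∷ lab) f else ε)
             (validFrom-old v O x η w lab w≢v))) ⟩
      _ ≈⟨ old (elem w O) (elem⇒ v>O) ⟩
      _ ≡⟨ cong (λ b → if b ∨ elem w O then branch b w else ε) (≢⇒≡ᵇ w≢v) ⟨
      _ ∎
      where
      old : ∀ b → (b ≡ true → v > w) →
            ∑ Ls (λ lab → if b ∧ validFrom (suc v) O η lab then decorated v O (x ∷ η) (suc w ∷ lab) f else ε)
            ≈ (if b then ∑D O η (insertWith w x O f) else ε)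
      old false _ = ∑-ε Ls
      old true  e = trans
        (∑-cong Ls λ lab → if-cong (validFrom (suc v) O η lab) (decorated-old v O x η w lab f v>O (e ≡.refl)))
        (∑-labellings N (suc v) O η (insertWith w x O f) (weaken v>O ∷ ap) l′)
    later : ∀ {w} → v > w → labelled w ≈ ∑D O η (insertWith w x O f)
    later v>w rewrite ≢⇒≡ᵇ (ℕₚ.<⇒≢ v>w) = refl
    opens : ∀ x → ∑D O η (λ q us G → f (x ∷ q) us G) ∙ (if isWhite x then ∑D (v ∷ O) η (openWith f) else ε) ≈
                  ∑ (unshuffles O η) (λ (η₀ , us) → ∑ (D (x ∷ η₀)) (λ (q , G) → f q us G))
    opens (fsuc j) = trans (identityʳ _) (∑-cong (unshuffles O η) λ (η₀ , us) → sym (∑-D-black j η₀ _))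
    opens fzero    = begin
      _ ≈⟨ ∙-congˡ (∑-unshuffles-open v O η (λ η₀ us → ∑ (D η₀) (λ (q , G) → openWith f q us G))) ⟩
      _ ≈⟨ ∙-congˡ (∑-cong (unshuffles O η) λ (η₀ , us) → ∑-cong (unshuffle η₀) λ (α , β) → ∑-swap (D α) (allFin m) _) ⟩
      _ ≈⟨ ∑-∙ (unshuffles O η) _ _ ⟨
      _ ≈⟨ ∑-cong (unshuffles O η) (λ (η₀ , us) → ∑-D-white η₀ _) ⟨
      _ ∎
    first : ∑D O η consWith ∙ labelled v ≈
            ∑ (unshuffles O η) (λ (η₀ , us) → ∑ (D (x ∷ η₀)) (λ (q , G) → f q us G))
    first rewrite ≡ᵇ-refl v = opens x

  allLists-length : ∀ {A : Set} (xs : List A) k → All (λ ys → length ys ≡ k) (allLists xs k)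
  allLists-length xs zero    = ≡.refl ∷ []
  allLists-length xs (suc k) = All-concatMap⁺ (All.universal
    (λ x → Allₚ.map⁺ (All.map (cong suc) (allLists-length xs k))) xs)

  nonzero : List ℕ → Bool
  nonzero = any (λ l → not (l ≡ᵇ 0))

  -- The labelling by zeros is the only one without a nonzero label. It stands for the empty
  -- extraction, which the coproduct lists separately as the tree tensored with the unit.
  ∑-zero-labelling : ∀ N k (g : List ℕ → C) →
    ∑ (allLists (upTo (suc N)) k) (λ lab → if nonzero lab then ε else g lab) ≈ g (replicate k 0)
  ∑-zero-labelling N zero    g = identityʳ _
  ∑-zero-labelling N (suc k) g = begin
    _ ≈⟨ ∑-label N k _ ⟩
    _ ≈⟨ ∙-cong (∑-zero-labelling N k (g ∘ (0 ∷_))) (trans (∑-cong (upTo N) λ w → ∑-ε (allLists (upTo (suc N)) k)) (∑-ε (upTo N))) ⟩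
    _ ≈⟨ identityʳ _ ⟩
    _ ∎

  term-zero : ∀ v η f → term v [] η (replicate (length η) 0) f ≈ f η [] []
  term-zero v []      f = identityʳ _
  term-zero v (x ∷ η) f = term-zero (suc v) η (λ q us G → f (x ∷ q) us G)

  -- The bridge from the given coproduct to the recursion: the facts about Δ of a tree are drawn
  -- from this identity, in the monoid of scalars or in that of types.
  ∑-ΔRCTterms : ∀ i η (f : Mono × Mono → C) →
    ∑ (ΔRCTterms (rct i η)) f ≈ f ([] , rct i η ∷ []) ∙ ∑ (D η) (λ (q , G) → f (rct i q ∷ [] , G))
  ∑-ΔRCTterms i η f = begin
    f (rct i η ∷ [] , []) ∙ (f ([] , rct i η ∷ []) ∙ _)
      ≈⟨ x∙yz≈y∙xz _ _ _ ⟩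
    f ([] , rct i η ∷ []) ∙ (f (rct i η ∷ [] , []) ∙ _)
      ≈⟨ ∙-congˡ (∙-congˡ (trans (∑-concatMap termsOf (extractions η) f) (∑-cong (extractions η) λ lab →
           ∑-map _ (allLists (allFin m) (length (mins lab))) f))) ⟩
    _ ∙ (_ ∙ ∑ (extractions η) contribution)
      ≈⟨ ∙-congˡ (∙-congˡ (∑-filter _ Ls contribution)) ⟩
    -- The separate term with the unit on the right is written as the contribution of the zero
    -- labelling, so that the sum runs over all valid labellings.
    _ ≈⟨ ∙-congˡ (∙-cong (sym (trans (∑-zero-labelling (length η) (length η) (λ lab → term 0 [] η lab g)) (term-zero 0 η g)))
           (∑-cong-All Ls (All.map (λ {lab} e → reflexive (cong₂ (λ b c → if b then c else ε)
             (≡.trans (≟-does (validLab η lab)) (validLab≡ η lab e)) (contribution≡ lab))) (allLists-length _ (length η))))) ⟩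
    _ ≈⟨ ∙-congˡ (∑-∙ Ls _ _) ⟨
    _ ≈⟨ ∙-congˡ (∑-cong Ls λ lab → combine (validFrom 0 [] η lab) (nonzero lab) (decorated 0 [] η lab g)) ⟩
    _ ∙ ∑ Ls (λ lab → term 0 [] η lab g)
      ≈⟨ ∙-congˡ (∑-labellings (length η) 0 [] η g ([] ∷ []) ℕₚ.≤-refl) ⟩
    _ ∙ (∑ (D η) (λ (q , G) → f (rct i q ∷ [] , G)) ∙ ε)
      ≈⟨ ∙-congˡ (identityʳ _) ⟩
    _ ∎
    where
    open import Algebra.Properties.CommutativeSemigroup commutativeSemigroup using (x∙yz≈y∙xz)
    Ls = labellings (length η)
    g : Test
    g q us G = f (rct i q ∷ [] , G)
    termsOf : List ℕ → List (Mono × Mono)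
    termsOf lab = map (λ ns → ( rct i (quotWord (triples η lab) ns) ∷ [] , newTrees (triples η lab) (mins lab) ns))
                      (allLists (allFin m) (length (mins lab)))
    contribution : List ℕ → C
    contribution lab = ∑ (allLists (allFin m) (length (mins lab))) λ ns →
      f (rct i (quotWord (triples η lab) ns) ∷ [] , newTrees (triples η lab) (mins lab) ns)
    contribution≡ : ∀ lab → contribution lab ≡ decorated 0 [] η lab g
    contribution≡ lab = cong₂ (λ tr ms → ∑ (allLists (allFin m) (length ms)) λ ns →
      f (rct i (quotWord tr ns) ∷ [] , newTrees tr ms ns)) (triples≡triplesFrom η lab) (mins≡minsFrom lab)
    combine : ∀ b c t → (if c then ε else (if b then t else ε)) ∙ (if b ∧ c then t else ε) ≈ (if b then t else ε)
    combine false false t = identityˡ _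
    combine false true  t = identityˡ _
    combine true  false t = identityʳ _
    combine true  true  t = identityˡ _

-- Formal linear combinations

∧-≡true : ∀ {a b} → a ∧ b ≡ true → a ≡ true × b ≡ true
∧-≡true {true} {true} _ = ≡.refl , ≡.refl

all-∈ : ∀ {a} {A : Set a} (p : A → Bool) xs → all p xs ≡ true → ∀ {x} → x ∈ xs → p x ≡ true
all-∈ p (x ∷ xs) e (here ≡.refl) = proj₁ (∧-≡true {p x} e)
all-∈ p (x ∷ xs) e (there x∈)    = all-∈ p xs (proj₂ (∧-≡true {p x} e)) x∈

all-true : ∀ {a} {A : Set a} (p : A → Bool) xs → (∀ x → p x ≡ true) → all p xs ≡ true
all-true p []       e = ≡.refl
all-true p (x ∷ xs) e rewrite e x = all-true p xs e

≡ᵇ⇒≡ : ∀ {k l} → (k ≡ᵇ l) ≡ true → k ≡ l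
≡ᵇ⇒≡ {k} {l} e = ℕₚ.≡ᵇ⇒≡ k l (≡.subst Bool.T (≡.sym e) _)

module MonoEquality {c ℓ : Level} (F : CharZeroField c ℓ) (m : ℕ) where
  open RCTHopf F m renaming (_≈_ to _≈H_; ε to εH)
  open Extraction F m using (Word)

  eqWord⇒≡ : ∀ η θ → eqWord η θ ≡ true → η ≡ θ
  eqWord⇒≡ []      []      e = ≡.refl
  eqWord⇒≡ (x ∷ η) (y ∷ θ) e with x ≟F y
  ... | yes ≡.refl = cong (x ∷_) (eqWord⇒≡ η θ e)

  eqWord-refl : ∀ η → eqWord η η ≡ true
  eqWord-refl []      = ≡.refl
  eqWord-refl (x ∷ η) with x ≟F x
  ... | yes _   = eqWord-refl η
  ... | no x≢x = ⊥-elim (x≢x ≡.refl)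

  eqRCT⇒≡ : ∀ t u → eqRCT t u ≡ true → t ≡ u
  eqRCT⇒≡ (rct i η) (rct j θ) e with i ≟F j
  ... | yes ≡.refl = cong (rct i) (eqWord⇒≡ η θ e)

  eqRCT-refl : ∀ t → eqRCT t t ≡ true
  eqRCT-refl (rct i η) with i ≟F i
  ... | yes _   = eqWord-refl η
  ... | no i≢i = ⊥-elim (i≢i ≡.refl)

  ↭⇒count≡ : ∀ {M N} → M ↭ N → ∀ t → count t M ≡ count t N
  ↭⇒count≡ ↭.refl          t = ≡.refl
  ↭⇒count≡ (prep u p)      t with eqRCT t u
  ... | true  = cong suc (↭⇒count≡ p t)
  ... | false = ↭⇒count≡ p t
  ↭⇒count≡ (swap u v p)    t with eqRCT t u | eqRCT t v
  ... | true  | true  = cong (suc ∘ suc) (↭⇒count≡ p t)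
  ... | true  | false = cong suc (↭⇒count≡ p t)
  ... | false | true  = cong suc (↭⇒count≡ p t)
  ... | false | false = ↭⇒count≡ p t
  ↭⇒count≡ (↭.trans p q)   t = ≡.trans (↭⇒count≡ p t) (↭⇒count≡ q t)

  count⇒∈ : ∀ t M {n} → count t M ≡ suc n → t ∈ M
  count⇒∈ t (u ∷ M) e with eqRCT t u in q
  ... | true  = here (eqRCT⇒≡ t u q)
  ... | false = there (count⇒∈ t M e)

  count-here : ∀ t M → count t (t ∷ M) ≡ suc (count t M)
  count-here t M rewrite eqRCT-refl t = ≡.refl

  count-cancel : ∀ s t M N → count s (t ∷ M) ≡ count s (t ∷ N) → count s M ≡ count s N
  count-cancel s t M N e with eqRCT s t
  ... | true  = ℕₚ.suc-injective e
  ... | false = e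

  count≡⇒↭ : ∀ M N → (∀ t → count t M ≡ count t N) → M ↭ N
  count≡⇒↭ []      []      e = ↭.refl
  count≡⇒↭ []      (u ∷ N) e = case ≡.trans (e u) (count-here u N) of λ ()
  count≡⇒↭ (t ∷ M) N       e with ∈-∃++ (count⇒∈ t N (≡.trans (≡.sym (e t)) (count-here t M)))
  ... | ys , zs , ≡.refl = ↭.trans
    (prep t (count≡⇒↭ M (ys ++ zs) λ s →
      count-cancel s t M (ys ++ zs) (≡.trans (e s) (↭⇒count≡ (shift t ys zs) s))))
    (↭-sym (shift t ys zs))

  -- `eqMono` compares multiplicities at trees occurring in M or N; at every other tree both
  -- multiplicities are zero.
  eqMono⇒↭ : ∀ {M N} → eqMono M N ≡ true → M ↭ N
  eqMono⇒↭ {M} {N} e = count≡⇒↭ M N counts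
    where
    agree : ∀ {t} → t ∈ M ++ N → count t M ≡ count t N
    agree = ≡ᵇ⇒≡ ∘ all-∈ _ (M ++ N) e
    counts : ∀ t → count t M ≡ count t N
    counts t with count t M in p | count t N in q
    ... | zero  | zero  = ≡.refl
    ... | suc _ | _     = ≡.trans (≡.sym p) (≡.trans (agree (∈-++⁺ˡ (count⇒∈ t M p))) q)
    ... | zero  | suc _ = ≡.trans (≡.sym p) (≡.trans (agree (∈-++⁺ʳ M (count⇒∈ t N q))) q)

  ↭⇒eqMono : ∀ {M N} → M ↭ N → eqMono M N ≡ true
  ↭⇒eqMono {M} {N} p = all-true _ (M ++ N) λ t →
    ≡.trans (cong (_≡ᵇ count t N) (↭⇒count≡ p t)) (≡ᵇ-refl (count t N))

module Integral {c ℓ} (R : CommutativeRing c ℓ) where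
  open CommutativeRing R renaming (Carrier to K)
  open ListSum +-commutativeMonoid
  open import Relation.Binary.Reasoning.Setoid setoid
  open import Algebra.Properties.Ring ring using (-‿distribˡ-*; -0#≈0#; -‿+-comm)
  open import Algebra.Properties.CommutativeSemigroup *-commutativeSemigroup using (x∙yz≈y∙xz)

  ∑-distribˡ : ∀ (xs : List A) k (f : A → K) → ∑ xs (λ x → k * f x) ≈ k * ∑ xs f
  ∑-distribˡ []       k f = sym (zeroʳ k)
  ∑-distribˡ (x ∷ xs) k f = trans (+-congˡ (∑-distribˡ xs k f)) (sym (distribˡ k _ _))

  -- The linear extension of φ, evaluated at p.
  ∫ : List (K × B) → (B → K) → K
  ∫ p φ = ∑ p (λ (k , b) → k * φ b)

  ∫-cong : ∀ (p : List (K × B)) {φ ψ : B → K} → (∀ b → φ b ≈ ψ b) → ∫ p φ ≈ ∫ p ψ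
  ∫-cong p e = ∑-cong p (λ (k , b) → *-congˡ (e b))

  ∫-++ : ∀ (p q : List (K × B)) φ → ∫ (p ++ q) φ ≈ ∫ p φ + ∫ q φ
  ∫-++ p q φ = ∑-++ p q _

  ∫-+ : ∀ (p : List (K × B)) φ ψ → ∫ p (λ b → φ b + ψ b) ≈ ∫ p φ + ∫ p ψ
  ∫-+ p φ ψ = trans (∑-cong p (λ _ → distribˡ _ _ _)) (∑-∙ p _ _)

  ∫-*ˡ : ∀ (p : List (K × B)) k φ → ∫ p (λ b → k * φ b) ≈ k * ∫ p φ
  ∫-*ˡ p k φ = trans (∑-cong p (λ _ → x∙yz≈y∙xz _ _ _)) (∑-distribˡ p k _)

  ∫-0 : ∀ (p : List (K × B)) → ∫ p (λ _ → 0#) ≈ 0#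
  ∫-0 p = trans (∑-cong p (λ _ → zeroʳ _)) (∑-ε p)

  ∫-∑-swap : ∀ (p : List (K × B)) (xs : List A) (f : B → A → K) →
             ∫ p (λ b → ∑ xs (f b)) ≈ ∑ xs (λ x → ∫ p (λ b → f b x))
  ∫-∑-swap p xs f = trans (∑-cong p (λ (k , b) → sym (∑-distribˡ xs k (f b)))) (∑-swap p xs _)

  ∫-swap : ∀ (p : List (K × A)) (q : List (K × B)) (φ : A → B → K) →
           ∫ p (λ x → ∫ q (φ x)) ≈ ∫ q (λ y → ∫ p (λ x → φ x y))
  ∫-swap p q φ = trans (∫-∑-swap p q _) (∑-cong q (λ (k , y) → ∫-*ˡ p k (λ x → φ x y)))

  ∫-scaleMap : ∀ k (g : A → B) (p : List (K × A)) φ →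
               ∫ (map (λ (l , x) → k * l , g x) p) φ ≈ k * ∫ p (φ ∘ g)
  ∫-scaleMap k g p φ = trans (∑-map _ p _) (trans (∑-cong p (λ _ → *-assoc _ _ _)) (∑-distribˡ p k _))

  -- The transpose rule: integrating over the image of a linear map given on basis elements means
  -- pulling the test function back. Products, Δ and the antipode are all evaluated through it.
  ∫-concatMap : ∀ (h : K × A → List (K × B)) (p : List (K × A)) φ ψ →
                (∀ k x → ∫ (h (k , x)) φ ≈ k * ψ x) → ∫ (concatMap h p) φ ≈ ∫ p ψ
  ∫-concatMap h p φ ψ e = trans (∑-concatMap h p _) (∑-cong p (λ (k , x) → e k x))

  ∫-pure : ∀ (b : B) φ → ∫ ((1# , b) ∷ []) φ ≈ φ b
  ∫-pure b φ = trans (+-identityʳ _) (*-identityˡ _)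

  ∫-neg : ∀ (p : List (K × B)) φ → ∫ (map (λ (k , b) → - k , b) p) φ ≈ - ∫ p φ
  ∫-neg []            φ = sym -0#≈0#
  ∫-neg ((k , b) ∷ p) φ = trans (+-cong (sym (-‿distribˡ-* _ _)) (∫-neg p φ)) (-‿+-comm _ _)

module FreeModule {c ℓ : Level} (F : CharZeroField c ℓ) (m : ℕ)
  (B : Set) (eqB : B → B → Bool) (_~_ : B → B → Set) (~-isEquivalence : IsEquivalence _~_)
  (eqB⇒~ : ∀ {x y} → eqB x y ≡ true → x ~ y) (~⇒eqB : ∀ {x y} → x ~ y → eqB x y ≡ true) where
  open CharZeroField F using (commRing)
  open CommutativeRing commRing renaming (Carrier to K)
  open RCTHopf.FreeMod F m B eqB
  open ListSum +-commutativeMonoid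
  open Integral commRing
  open IsEquivalence ~-isEquivalence using () renaming (refl to ~-refl; sym to ~-sym; trans to ~-trans)
  open import Relation.Binary.Reasoning.Setoid setoid
  open import Algebra.Properties.Ring ring using (-0#≈0#; -‿+-comm; x∙y⁻¹≈ε⇒x≈y; x≈y⇒x∙y⁻¹≈ε)

  Respects~ : (B → K) → Set ℓ
  Respects~ φ = ∀ {x y} → x ~ y → φ x ≈ φ y

  eqB-congˡ : ∀ {x y} z → x ~ y → eqB z x ≡ eqB z y
  eqB-congˡ {x} {y} z x~y with eqB z x in p | eqB z y in q
  ... | true  | true  = ≡.refl
  ... | false | false = ≡.refl
  ... | true  | false = ≡.trans (≡.sym (~⇒eqB (~-trans (eqB⇒~ p) x~y))) q
  ... | false | true  = ≡.trans (≡.sym p) (~⇒eqB (~-trans (eqB⇒~ q) (~-sym x~y)))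

  eqB-congʳ : ∀ {x y} z → x ~ y → eqB x z ≡ eqB y z
  eqB-congʳ {x} {y} z x~y with eqB x z in p | eqB y z in q
  ... | true  | true  = ≡.refl
  ... | false | false = ≡.refl
  ... | true  | false = ≡.trans (≡.sym (~⇒eqB (~-trans (~-sym x~y) (eqB⇒~ p)))) q
  ... | false | true  = ≡.trans (≡.sym p) (~⇒eqB (~-trans x~y (eqB⇒~ q)))

  δ : B → B → K
  δ x y = if eqB y x then 1# else 0#

  δ-respects : ∀ x → Respects~ (δ x)
  δ-respects x y~z = reflexive (cong (λ b → if b then 1# else 0#) (eqB-congʳ x y~z))

  coeff≈∫δ : ∀ p x → coeff p x ≈ ∫ p (δ x)
  coeff≈∫δ []            x = refl
  coeff≈∫δ ((k , y) ∷ p) x with eqB y x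
  ... | true  = +-cong (sym (*-identityʳ k)) (coeff≈∫δ p x)
  ... | false = trans (coeff≈∫δ p x) (sym (trans (+-congʳ (zeroʳ k)) (+-identityˡ _)))

  -- The coefficient at x is the pairing with the indicator function of the class of x, which is
  -- invariant.
  ∫≈⇒≈L : ∀ p q → (∀ φ → Respects~ φ → ∫ p φ ≈ ∫ q φ) → p ≈L q
  ∫≈⇒≈L p q e x = trans (coeff≈∫δ p x) (trans (e (δ x) (δ-respects x)) (sym (coeff≈∫δ q x)))

  remove : B → Lin → Lin
  remove x []            = []
  remove x ((k , y) ∷ p) = if eqB y x then remove x p else (k , y) ∷ remove x p

  remove-length : ∀ x p → length (remove x p) ≤ length p
  remove-length x []            = z≤n
  remove-length x ((k , y) ∷ p) with eqB y x
  ... | true  = ℕₚ.m≤n⇒m≤1+n (remove-length x p)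
  ... | false = s≤s (remove-length x p)

  coeff-remove-~ : ∀ x p {y} → x ~ y → coeff (remove x p) y ≈ 0#
  coeff-remove-~ x []            x~y = refl
  coeff-remove-~ x ((k , z) ∷ p) {y} x~y with eqB z x in e
  ... | true  = coeff-remove-~ x p x~y
  ... | false rewrite ≡.trans (≡.sym (eqB-congˡ z x~y)) e = coeff-remove-~ x p x~y

  coeff-remove-≁ : ∀ x p {y} → eqB x y ≡ false → coeff (remove x p) y ≈ coeff p y
  coeff-remove-≁ x []            x≁y = refl
  coeff-remove-≁ x ((k , z) ∷ p) {y} x≁y with eqB z x in e
  ... | true  rewrite ≡.trans (eqB-congʳ y (eqB⇒~ e)) x≁y = coeff-remove-≁ x p x≁y
  ... | false with eqB z y
  ...   | true  = +-congˡ (coeff-remove-≁ x p x≁y)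
  ...   | false = coeff-remove-≁ x p x≁y

  ∫-remove : ∀ x p φ → Respects~ φ → ∫ p φ ≈ coeff p x * φ x + ∫ (remove x p) φ
  ∫-remove x []            φ r = sym (trans (+-identityʳ _) (zeroˡ _))
  ∫-remove x ((k , y) ∷ p) φ r with eqB y x in e
  ... | true  = begin
    k * φ y + ∫ p φ                                    ≈⟨ +-cong (*-congˡ (r (eqB⇒~ e))) (∫-remove x p φ r) ⟩
    k * φ x + (coeff p x * φ x + ∫ (remove x p) φ)     ≈⟨ +-assoc _ _ _ ⟨
    (k * φ x + coeff p x * φ x) + ∫ (remove x p) φ     ≈⟨ +-congʳ (distribʳ _ _ _) ⟨
    (k + coeff p x) * φ x + ∫ (remove x p) φ           ∎
  ... | false = trans (+-congˡ (∫-remove x p φ r)) (x∙yz≈y∙xz _ _ _)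
    where open import Algebra.Properties.CommutativeSemigroup
            (CommutativeMonoid.commutativeSemigroup +-commutativeMonoid) using (x∙yz≈y∙xz)

  -- Terms cancel only after equivalent basis elements are collected, so the whole class of the
  -- first term is removed at once; it contributes its coefficient, which is zero, times φ x. The
  -- number n bounds a recursion that is not structural.
  ∫-null : ∀ n p → length p ≤ n → (∀ x → coeff p x ≈ 0#) → ∀ φ → Respects~ φ → ∫ p φ ≈ 0#
  ∫-null n       []            _       e φ r = refl
  ∫-null (suc n) ((k , x) ∷ p) (s≤s l) e φ r = begin
    ∫ ((k , x) ∷ p) φ
      ≈⟨ ∫-remove x ((k , x) ∷ p) φ r ⟩
    coeff ((k , x) ∷ p) x * φ x + ∫ (remove x ((k , x) ∷ p)) φ
      ≈⟨ +-congʳ (trans (*-congʳ (e x)) (zeroˡ _)) ⟩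
    0# + ∫ (remove x ((k , x) ∷ p)) φ
      ≈⟨ +-identityˡ _ ⟩
    ∫ (remove x ((k , x) ∷ p)) φ
      ≈⟨ ∫-null n (remove x ((k , x) ∷ p)) (ℕₚ.≤-trans shorter l) vanishes φ r ⟩
    0# ∎
    where
    shorter : length (remove x ((k , x) ∷ p)) ≤ length p
    shorter rewrite ~⇒eqB (~-refl {x}) = remove-length x p
    vanishes : ∀ y → coeff (remove x ((k , x) ∷ p)) y ≈ 0#
    vanishes y with eqB x y in q
    ... | true  = coeff-remove-~ x ((k , x) ∷ p) (eqB⇒~ q)
    ... | false = trans (coeff-remove-≁ x ((k , x) ∷ p) q) (e y)

  coeff-++ : ∀ p q x → coeff (p ++ q) x ≈ coeff p x + coeff q x
  coeff-++ []            q x = sym (+-identityˡ _)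
  coeff-++ ((k , y) ∷ p) q x with eqB y x
  ... | true  = trans (+-congˡ (coeff-++ p q x)) (sym (+-assoc _ _ _))
  ... | false = coeff-++ p q x

  coeff-negL : ∀ p x → coeff (negL p) x ≈ - coeff p x
  coeff-negL []            x = sym -0#≈0#
  coeff-negL ((k , y) ∷ p) x with eqB y x
  ... | true  = trans (+-congˡ (coeff-negL p x)) (-‿+-comm _ _)
  ... | false = coeff-negL p x

  -- Passing to the difference leaves one list with vanishing coefficients, in place of two lists to
  -- be matched.
  ≈L⇒∫≈ : ∀ p q → p ≈L q → ∀ φ → Respects~ φ → ∫ p φ ≈ ∫ q φ
  ≈L⇒∫≈ p q e φ r = x∙y⁻¹≈ε⇒x≈y _ _ (begin
    ∫ p φ - ∫ q φ          ≈⟨ +-congˡ (∫-neg q φ) ⟨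
    ∫ p φ + ∫ (negL q) φ   ≈⟨ ∫-++ p (negL q) φ ⟨
    ∫ (p ++ negL q) φ      ≈⟨ ∫-null _ (p ++ negL q) ℕₚ.≤-refl null φ r ⟩
    0#                     ∎)
    where
    null : ∀ x → coeff (p ++ negL q) x ≈ 0#
    null x = trans (coeff-++ p (negL q) x) (trans (+-congˡ (coeff-negL q x)) (x≈y⇒x∙y⁻¹≈ε (e x)))

-- The coproduct

module Coproduct {c ℓ : Level} (F : CharZeroField c ℓ) (m : ℕ) where
  open CharZeroField F using (commRing)
  open CommutativeRing commRing renaming (Carrier to K)
  open RCTHopf F m renaming (_≈_ to _≈H_; ε to εH)
  open Extraction F m
  open ListSum +-commutativeMonoid
  open Sums +-commutativeMonoid
  open BlockSplitting F m +-commutativeMonoid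
  open LabelSums F m +-commutativeMonoid using (∑-ΔRCTterms)
  open Integral commRing
  open import Relation.Binary.Reasoning.Setoid setoid

  Respects₁ : (Mono → K) → Set ℓ
  Respects₁ φ = ∀ {A A′} → A ↭ A′ → φ A ≈ φ A′

  Respects₂ : (Mono → Mono → K) → Set ℓ
  Respects₂ φ = ∀ {A A′ B B′} → A ↭ A′ → B ↭ B′ → φ A B ≈ φ A′ B′

  Respects₃ : (Mono → Mono → Mono → K) → Set ℓ
  Respects₃ φ = ∀ {A A′ B B′ C C′} → A ↭ A′ → B ↭ B′ → C ↭ C′ → φ A B C ≈ φ A′ B′ C′

  ∫Δ₁ : RCT → (Mono → Mono → K) → K
  ∫Δ₁ t φ = ∫ (ΔRCT t) (λ (A , B) → φ A B)

  ∫Δ : Mono → (Mono → Mono → K) → K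
  ∫Δ M φ = ∫ (ΔMono M) (λ (A , B) → φ A B)

  ∫Δ₁-cong : ∀ t {φ ψ} → (∀ A B → φ A B ≈ ψ A B) → ∫Δ₁ t φ ≈ ∫Δ₁ t ψ
  ∫Δ₁-cong t e = ∫-cong (ΔRCT t) (λ (A , B) → e A B)

  ∫Δ-cong : ∀ M {φ ψ} → (∀ A B → φ A B ≈ ψ A B) → ∫Δ M φ ≈ ∫Δ M ψ
  ∫Δ-cong M e = ∫-cong (ΔMono M) (λ (A , B) → e A B)

  ∫Δ₁-expand : ∀ i η φ → ∫Δ₁ (rct i η) φ ≈ φ [] (rct i η ∷ []) + ∑ (D η) (λ (q , G) → φ (rct i q ∷ []) G)
  ∫Δ₁-expand i η φ = begin
    ∫Δ₁ (rct i η) φ                                    ≈⟨ ∑-map {B = K × Mono × Mono} (1# ,_) (ΔRCTterms (rct i η)) (λ (k , A , B) → k * φ A B) ⟩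
    ∑ (ΔRCTterms (rct i η)) (λ (A , B) → 1# * φ A B)   ≈⟨ ∑-cong (ΔRCTterms (rct i η)) (λ _ → *-identityˡ _) ⟩
    ∑ (ΔRCTterms (rct i η)) (λ (A , B) → φ A B)        ≈⟨ ∑-ΔRCTterms i η _ ⟩
    _ ∎

  ∫-*² : ∀ p q (φ : Mono × Mono → K) →
         ∫ (p *² q) φ ≈ ∫ p (λ (A , A′) → ∫ q (λ (B , B′) → φ (A ++ B , A′ ++ B′)))
  ∫-*² p q φ = ∫-concatMap _ p φ _ (λ k (A , A′) → ∫-scaleMap k (λ (B , B′) → (A ++ B , A′ ++ B′)) q φ)

  ∫Δ-[] : ∀ φ → ∫Δ [] φ ≈ φ [] []
  ∫Δ-[] φ = ∫-pure ([] , []) (λ (A , B) → φ A B)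

  ∫Δ-∷ : ∀ t M φ → ∫Δ (t ∷ M) φ ≈ ∫Δ₁ t (λ A A′ → ∫Δ M (λ B B′ → φ (A ++ B) (A′ ++ B′)))
  ∫Δ-∷ t M φ = ∫-*² (ΔRCT t) (ΔMono M) _

  ∫Δ-++ : ∀ M N φ → ∫Δ (M ++ N) φ ≈ ∫Δ M (λ A A′ → ∫Δ N (λ B B′ → φ (A ++ B) (A′ ++ B′)))
  ∫Δ-++ []      N φ = sym (∫Δ-[] λ A A′ → ∫Δ N (λ B B′ → φ (A ++ B) (A′ ++ B′)))
  ∫Δ-++ (t ∷ M) N φ = begin
    ∫Δ (t ∷ M ++ N) φ
      ≈⟨ ∫Δ-∷ t (M ++ N) φ ⟩
    _ ≈⟨ ∫Δ₁-cong t (λ A A′ → ∫Δ-++ M N _) ⟩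
    _ ≈⟨ ∫Δ₁-cong t (λ A A′ → ∫Δ-cong M λ B B′ → ∫Δ-cong N λ C C′ →
           reflexive (cong₂ φ (++-assoc A B C) (++-assoc A′ B′ C′))) ⟨
    _ ≈⟨ ∫Δ-∷ t M _ ⟨
    _ ∎

  ∫Δ-singleton : ∀ t φ → ∫Δ (t ∷ []) φ ≈ ∫Δ₁ t φ
  ∫Δ-singleton t φ = trans (∫Δ-∷ t [] φ) (∫Δ₁-cong t λ A A′ →
    trans (∫Δ-[] λ B B′ → φ (A ++ B) (A′ ++ B′)) (reflexive (cong₂ φ (++-identityʳ A) (++-identityʳ A′))))

  shift₂ : ∀ {φ} → Respects₂ φ → ∀ A A′ → Respects₂ (λ B B′ → φ (A ++ B) (A′ ++ B′))
  shift₂ r A A′ p p′ = r (++⁺ˡ A p) (++⁺ˡ A′ p′)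

  -- Δ of a monomial is a product over its list of trees, and invariant tests cannot see the order
  -- of the factors.
  ∫Δ-↭ : ∀ {M N} → M ↭ N → ∀ φ → Respects₂ φ → ∫Δ M φ ≈ ∫Δ N φ
  ∫Δ-↭ ↭.refl        φ r = refl
  ∫Δ-↭ (prep {M} {N} t p) φ r = begin
    ∫Δ (t ∷ M) φ ≈⟨ ∫Δ-∷ t M φ ⟩
    _            ≈⟨ ∫Δ₁-cong t (λ A A′ → ∫Δ-↭ p _ (shift₂ r A A′)) ⟩
    _            ≈⟨ ∫Δ-∷ t N φ ⟨
    ∫Δ (t ∷ N) φ ∎
  ∫Δ-↭ (swap {M} {N} t u p) φ r = begin
    ∫Δ (t ∷ u ∷ M) φ
      ≈⟨ two t u M ⟩
    _ ≈⟨ ∫Δ₁-cong t (λ A A′ → ∫Δ₁-cong u λ B B′ → trans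
           (∫Δ-↭ p _ (λ {C} {C′} {D} {D′} q q′ → r (++⁺ˡ A (++⁺ˡ B q)) (++⁺ˡ A′ (++⁺ˡ B′ q′))))
           (∫Δ-cong N λ C C′ → r (shifts A B) (shifts A′ B′))) ⟩
    _ ≈⟨ ∫-swap (ΔRCT t) (ΔRCT u) _ ⟩
    _ ≈⟨ two u t N ⟨
    ∫Δ (u ∷ t ∷ N) φ ∎
    where
    two : ∀ t u M → ∫Δ (t ∷ u ∷ M) φ ≈
      ∫Δ₁ t (λ A A′ → ∫Δ₁ u (λ B B′ → ∫Δ M (λ C C′ → φ (A ++ (B ++ C)) (A′ ++ (B′ ++ C′)))))
    two t u M = trans (∫Δ-∷ t (u ∷ M) φ) (∫Δ₁-cong t λ A A′ → ∫Δ-∷ u M _)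
  ∫Δ-↭ (↭.trans p q) φ r = trans (∫Δ-↭ p φ r) (∫Δ-↭ q φ r)

  WordTest : Set c
  WordTest = Word → Mono → Mono → K

  RespectsW : WordTest → Set ℓ
  RespectsW Φ = ∀ q → Respects₂ (Φ q)

  -- Together with `∑DΔ` this gives the two sides of coassociativity at a tree, without the terms
  -- whose first tensor factor is the unit; `∫Δ₁-coassoc` supplies those. The root is absorbed in
  -- the test.
  ∑DD-word : Word → WordTest → K
  ∑DD-word η Φ = ∑ (D η) (λ (q , G) → ∑ (D q) (λ (r , H) → Φ r H G))

  ∑DΔ : Word → WordTest → K
  ∑DΔ η Φ = ∑ (D η) (λ (q , G) → ∫Δ G (Φ q))

  ∫Δ-tree∷ : ∀ k β G (φ : Mono → Mono → K) → ∫Δ (rct k β ∷ G) φ ≈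
    ∫Δ G (λ B B′ → φ B (rct k β ∷ B′)) + ∑ (D β) (λ (q , H) → ∫Δ G (λ B B′ → φ (rct k q ∷ B) (H ++ B′)))
  ∫Δ-tree∷ k β G φ = trans (∫Δ-∷ (rct k β) G φ) (∫Δ₁-expand k β _)

  -- A white head has three fates: it stays white, it is the minimum of a block in the first
  -- extraction, or it survives that and is a minimum in the second. On the other side the last two
  -- are the terms of Δ at the tree cut off at the head: the unit tensored with the tree, and the
  -- extractions from the tree.
  D-coassoc : ∀ n η → length η ≤ n → ∀ Φ → RespectsW Φ → ∑DD-word η Φ ≈ ∑DΔ η Φ
  D-coassoc n [] _ Φ r = +-congʳ (trans (+-identityʳ _) (sym (∫Δ-[] (Φ []))))
  D-coassoc (suc n) (fsuc j ∷ η) (s≤s l) Φ r = begin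
    ∑DD-word (black j ∷ η) Φ
      ≈⟨ ∑-D-black j η _ ⟩
    _ ≈⟨ ∑-cong (D η) (λ (q , G) → ∑-D-black j q _) ⟩
    ∑DD-word η (λ q → Φ (black j ∷ q))
      ≈⟨ D-coassoc n η l _ (λ q → r _) ⟩
    ∑DΔ η (λ q → Φ (black j ∷ q))
      ≈⟨ ∑-D-black j η _ ⟨
    ∑DΔ (black j ∷ η) Φ ∎
  D-coassoc (suc n) (fzero ∷ η) (s≤s l) Φ r = begin
    ∑DD-word (fzero ∷ η) Φ
      ≈⟨ ∑-D-white η _ ⟩
    _ ≈⟨ +-cong (trans (∑-cong (D η) (λ (q , G) → ∑-D-white q _)) (∑-∙ (D η) _ _))
                (∑-cong U λ (α , β) → ∑-cong (allFin m) λ k → ∑-cong (D α) λ (q , G) → ∑-D-black k q _) ⟩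
    (∑DD-word η (λ q → Φ (fzero ∷ q)) + ∑DU η nested) +
      ∑ U (λ (α , β) → ∑ (allFin m) λ k → ∑DD-word α (λ q A B → Φ (black k ∷ q) A (rct k β ∷ B)))
      ≈⟨ +-cong (+-cong (D-coassoc n η l _ (λ q → r _)) nested-eq)
                (∑-cong-All U (All.map (λ { {α , β} u → ∑-cong (allFin m) λ k →
                  D-coassoc n α u _ (λ q p p′ → r _ p (prep _ p′)) }) (unshuffle-≤ˡ η l))) ⟩
    (∑DΔ η (λ q → Φ (fzero ∷ q)) + ∑ U inner) + ∑ U outer
      ≈⟨ trans (+-assoc _ _ _) (+-congˡ (trans (+-comm _ _) (sym (∑-∙ U _ _)))) ⟩
    _ ≈⟨ +-congˡ (∑-cong U λ (α , β) → trans (∑-cong (allFin m) λ k → trans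
           (∑-cong (D α) λ (q , G) → ∫Δ-tree∷ k β G _) (∑-∙ (D α) _ _)) (∑-∙ (allFin m) _ _)) ⟨
    _ ≈⟨ ∑-D-white η _ ⟨
    ∑DΔ (fzero ∷ η) Φ ∎
    where
    U = unshuffle η
    nested : Word → Word → Mono → K
    nested q₁ q₂ G = ∑ (allFin m) λ k → ∑ (D q₁) λ (r , H) → Φ (black k ∷ r) (rct k q₂ ∷ H) G
    outer inner : Word × Word → K
    outer (α , β) = ∑ (allFin m) λ k → ∑DΔ α (λ q A B → Φ (black k ∷ q) A (rct k β ∷ B))
    inner (α , β) = ∑ (allFin m) λ k → ∑ (D α) λ (q , G) → ∑ (D β) λ (q₂ , H) →
                      ∫Δ G (λ B B′ → Φ (black k ∷ q) (rct k q₂ ∷ B) (H ++ B′))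
    nested-eq : ∑DU η nested ≈ ∑ U inner
    nested-eq = begin
      ∑DU η nested
        -- The quotient q is unshuffled into a rest and a block. Splitting η beforehand into α and β
        -- distributes the trees of G over the two sides; the side of β is then an extraction from
        -- the tree cut off, and the induction hypothesis applies to α.
        ≈⟨ ∑DU≈∑UDD (length η) η ℕₚ.≤-refl nested (λ q₁ q₂ p → ∑-cong (allFin m) λ k → ∑-cong (D q₁) λ _ → r _ ↭-refl p) ⟩
      ∑UDD η nested
        ≈⟨ ∑-cong-All U (All.map (λ { {α , β} u → begin
             _ ≈⟨ ∑-cong (D α) (λ _ → ∑-swap (D β) (allFin m) _) ⟩
             _ ≈⟨ ∑-swap (D α) (allFin m) _ ⟩
             _ ≈⟨ ∑-cong (allFin m) (λ k → begin
               _ ≈⟨ ∑-swap (D α) (D β) _ ⟩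
               _ ≈⟨ ∑-cong (D β) (λ (q₂ , G₂) → D-coassoc n α u (λ q A B → Φ (black k ∷ q) (rct k q₂ ∷ A) (B ++ G₂))
                      (λ q p p′ → r _ (prep _ p) (++⁺ʳ G₂ p′))) ⟩
               _ ≈⟨ ∑-swap (D β) (D α) _ ⟩
               _ ≈⟨ ∑-cong (D α) (λ (q , G) → ∑-cong (D β) λ (q₂ , H) → ∫Δ-cong G λ B B′ → r _ ↭-refl (++-comm B′ H)) ⟩
               _ ∎) ⟩
             inner (α , β) ∎ }) (unshuffle-≤ˡ η l)) ⟩
      ∑ U inner ∎

  ∫Δ₁-coassoc : ∀ t φ → Respects₃ φ →
    ∫Δ₁ t (λ A B → ∫Δ A (λ A₁ A₂ → φ A₁ A₂ B)) ≈ ∫Δ₁ t (λ A B → ∫Δ B (φ A))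
  ∫Δ₁-coassoc (rct i η) φ r = begin
    ∫Δ₁ t (λ A B → ∫Δ A (λ A₁ A₂ → φ A₁ A₂ B))
      ≈⟨ ∫Δ₁-expand i η _ ⟩
    ∫Δ [] (λ A₁ A₂ → φ A₁ A₂ (t ∷ [])) + ∑ (D η) (λ (q , G) → ∫Δ (rct i q ∷ []) (λ A₁ A₂ → φ A₁ A₂ G))
      ≈⟨ +-cong (∫Δ-[] (λ A₁ A₂ → φ A₁ A₂ (t ∷ []))) (∑-cong (D η) λ (q , G) → trans (∫Δ-singleton (rct i q) _) (∫Δ₁-expand i q _)) ⟩
    φ [] [] (t ∷ []) + ∑ (D η) (λ (q , G) → φ [] (rct i q ∷ []) G + ∑ (D q) (λ (s , H) → φ (rct i s ∷ []) H G))
      ≈⟨ +-congˡ (∑-∙ (D η) _ _) ⟩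
    φ [] [] (t ∷ []) + (∑ (D η) (λ (q , G) → φ [] (rct i q ∷ []) G) + ∑DD-word η (λ q → φ (rct i q ∷ [])))
      ≈⟨ +-assoc _ _ _ ⟨
    (φ [] [] (t ∷ []) + ∑ (D η) (λ (q , G) → φ [] (rct i q ∷ []) G)) + ∑DD-word η (λ q → φ (rct i q ∷ []))
      ≈⟨ +-cong (trans (∫Δ-singleton t _) (∫Δ₁-expand i η _))
                (sym (D-coassoc (length η) η ℕₚ.≤-refl _ (λ q → r ↭-refl))) ⟨
    ∫Δ (t ∷ []) (φ []) + ∑DΔ η (λ q → φ (rct i q ∷ []))
      ≈⟨ ∫Δ₁-expand i η _ ⟨
    ∫Δ₁ t (λ A B → ∫Δ B (φ A)) ∎
    where t = rct i η

  -- Both iterated coproducts are multiplicative, so agreement on trees propagates to forests. The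
  -- exchanges of integrals isolate the factor t from the factor M.
  ∫Δ-coassoc : ∀ M φ → Respects₃ φ →
    ∫Δ M (λ A B → ∫Δ A (λ A₁ A₂ → φ A₁ A₂ B)) ≈ ∫Δ M (λ A B → ∫Δ B (φ A))
  ∫Δ-coassoc []      φ r = begin
    _               ≈⟨ ∫Δ-[] (λ A B → ∫Δ A (λ A₁ A₂ → φ A₁ A₂ B)) ⟩
    ∫Δ [] (λ A₁ A₂ → φ A₁ A₂ [])  ≈⟨ trans (∫Δ-[] (λ A₁ A₂ → φ A₁ A₂ [])) (sym (∫Δ-[] (φ []))) ⟩
    ∫Δ [] (φ [])    ≈⟨ ∫Δ-[] (λ A B → ∫Δ B (φ A)) ⟨
    _ ∎
  ∫Δ-coassoc (t ∷ M) φ r = begin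
    _ ≈⟨ ∫Δ-∷ t M _ ⟩
    _ ≈⟨ ∫Δ₁-cong t (λ A A′ → ∫Δ-cong M λ B B′ → ∫Δ-++ A B _) ⟩
    _ ≈⟨ ∫Δ₁-cong t (λ A A′ → ∫-swap (ΔMono M) (ΔMono A) _) ⟩
    _ ≈⟨ ∫Δ₁-cong t (λ A A′ → ∫Δ-cong A λ A₁ A₂ →
           ∫Δ-coassoc M (λ B C D → φ (A₁ ++ B) (A₂ ++ C) (A′ ++ D)) (λ p q s → r (++⁺ˡ A₁ p) (++⁺ˡ A₂ q) (++⁺ˡ A′ s))) ⟩
    _ ≈⟨ ∫Δ₁-coassoc t (λ A₁ A₂ A′ → ∫Δ M (λ B B′ → ∫Δ B′ (λ C D → φ (A₁ ++ B) (A₂ ++ C) (A′ ++ D))))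
           (λ p q s → ∫Δ-cong M λ B B′ → ∫Δ-cong B′ λ C D → r (++⁺ʳ B p) (++⁺ʳ C q) (++⁺ʳ D s)) ⟩
    _ ≈⟨ ∫Δ₁-cong t (λ A A′ → ∫-swap (ΔMono M) (ΔMono A′) _) ⟨
    _ ≈⟨ ∫Δ₁-cong t (λ A A′ → ∫Δ-cong M λ B B′ → ∫Δ-++ A′ B′ _) ⟨
    _ ≈⟨ ∫Δ-∷ t M _ ⟨
    _ ∎

-- The antipode

module Antipode {c ℓ : Level} (F : CharZeroField c ℓ) (m : ℕ) where
  open CharZeroField F using (commRing)
  open CommutativeRing commRing renaming (Carrier to K)
  open RCTHopf F m renaming (_≈_ to _≈H_; ε to εH)
  open Extraction F m
  open Coproduct F m
  open ListSum +-commutativeMonoid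
  open Integral commRing
  open import Relation.Binary.Reasoning.Setoid setoid
  open import Algebra.Properties.Ring ring using (+-identityˡ-unique)

  ∫-*H : ∀ p q (φ : Mono → K) → ∫ (p *H q) φ ≈ ∫ p (λ M → ∫ q (λ N → φ (M ++ N)))
  ∫-*H p q φ = ∫-concatMap _ p φ _ (λ k M → ∫-scaleMap k (M ++_) q φ)

  ∫-scale : ∀ a p (φ : Mono → K) → ∫ (H.scale a p) φ ≈ a * ∫ p φ
  ∫-scale a p φ = ∫-scaleMap a id p φ

  ++-interchange : ∀ (A B C D : Mono) → (A ++ B) ++ (C ++ D) ↭ (A ++ C) ++ (B ++ D)
  ++-interchange A B C D = ↭.trans (↭-reflexive (++-assoc A B (C ++ D)))
    (↭.trans (++⁺ˡ A (shifts B C)) (↭-reflexive (≡.sym (++-assoc A C (B ++ D)))))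

  deg≥1 : ∀ η → 1 ≤ deg η
  deg≥1 []      = ℕₚ.≤-refl
  deg≥1 (x ∷ η) = ℕₚ.≤-trans (deg≥1 η) (ℕₚ.m≤n+m _ _)

  degMono≥1 : ∀ G → 1 ≤ length G → 1 ≤ degMono G
  degMono≥1 (rct i η ∷ G) _ = ℕₚ.≤-trans (deg≥1 η) (ℕₚ.m≤m+n _ _)

  D⁺-deg-< : ∀ η → All (λ (q , G) → deg q < deg η) (D⁺ η)
  D⁺-deg-< η = All.map (λ { {q , G} (e , ne) → ≡.subst (deg q <_) e (ℕₚ.m<m+n (deg q) (degMono≥1 G ne)) })
    (All.zip (extract⁺-deg (length η) η , extract⁺-nonempty (length η) η))

  -- The equation (S * id)(t) = 0 solved for S(t): the terms `1 ⊗ t` and `t ⊗ 1` contribute t and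
  -- S(t), and the other terms involve S at quotients of smaller degree. Trees have degree at least
  -- 1, so fuel equal to the degree does not run out.
  antipodeTree : ℕ → RCT → Hf
  antipodeTree zero    t         = 0H
  antipodeTree (suc n) (rct i η) = -H ((1# , rct i η ∷ []) ∷
    concatMap (λ (q , G) → antipodeTree n (rct i q) *H ((1# , G) ∷ [])) (D⁺ η))

  antipodeTree-fuel : ∀ n n′ i η → deg η ≤ n → deg η ≤ n′ → antipodeTree n (rct i η) ≡ antipodeTree n′ (rct i η)
  antipodeTree-fuel zero    n′       i η l l′ = case ℕₚ.≤-trans (deg≥1 η) l of λ ()
  antipodeTree-fuel (suc n) zero     i η l l′ = case ℕₚ.≤-trans (deg≥1 η) l′ of λ ()
  antipodeTree-fuel (suc n) (suc n′) i η l l′ = cong (λ p → -H ((1# , rct i η ∷ []) ∷ p))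
    (concatMap-cong-local (All.map (λ { {q , G} q<η → cong (_*H ((1# , G) ∷ []))
      (antipodeTree-fuel n n′ i q (ℕₚ.≤-pred (ℕₚ.≤-trans q<η l)) (ℕₚ.≤-pred (ℕₚ.≤-trans q<η l′))) }) (D⁺-deg-< η)))

  ∫S₁ : RCT → (Mono → K) → K
  ∫S₁ t φ = ∫ (antipodeTree (degRCT t) t) φ

  -- An antipode reverses products; in a commutative algebra it is therefore a morphism, determined
  -- by its values on trees.
  antipodeMono : Mono → Hf
  antipodeMono []      = 1H
  antipodeMono (t ∷ M) = antipodeTree (degRCT t) t *H antipodeMono M

  ∫S : Mono → (Mono → K) → K
  ∫S M φ = ∫ (antipodeMono M) φ

  ∫S-cong : ∀ M {φ ψ} → (∀ A → φ A ≈ ψ A) → ∫S M φ ≈ ∫S M ψ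
  ∫S-cong M = ∫-cong (antipodeMono M)

  ∫S-[] : ∀ φ → ∫S [] φ ≈ φ []
  ∫S-[] = ∫-pure []

  ∫S-∷ : ∀ t M φ → ∫S (t ∷ M) φ ≈ ∫S₁ t (λ A → ∫S M (λ B → φ (A ++ B)))
  ∫S-∷ t M φ = ∫-*H (antipodeTree (degRCT t) t) (antipodeMono M) φ

  ∫S-singleton : ∀ t φ → ∫S (t ∷ []) φ ≈ ∫S₁ t φ
  ∫S-singleton t φ = trans (∫S-∷ t [] φ) (∫-cong (antipodeTree (degRCT t) t) λ A →
    trans (∫S-[] λ B → φ (A ++ B)) (reflexive (cong φ (++-identityʳ A))))

  ∫S₁-recursion : ∀ i η φ → ∫S₁ (rct i η) φ ≈
    - (φ (rct i η ∷ []) + ∑ (D⁺ η) (λ (q , G) → ∫S (rct i q ∷ []) (λ A → φ (A ++ G))))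
  ∫S₁-recursion i η φ = begin
    ∫ (antipodeTree (deg η) (rct i η)) φ
      -- One additional unit of fuel lets the definition unfold, with `deg η` units left for the
      -- quotients.
      ≡⟨ cong (λ p → ∫ p φ) (antipodeTree-fuel (deg η) (suc (deg η)) i η ℕₚ.≤-refl (ℕₚ.n≤1+n _)) ⟩
    ∫ (antipodeTree (suc (deg η)) (rct i η)) φ
      ≈⟨ ∫-neg ((1# , rct i η ∷ []) ∷ concatMap step (D⁺ η)) φ ⟩
    - (1# * φ (rct i η ∷ []) + ∫ (concatMap step (D⁺ η)) φ)
      ≈⟨ -‿cong (+-cong (*-identityˡ _) (trans (∑-concatMap step (D⁺ η) _)
           (∑-cong-All (D⁺ η) (All.map (λ { {q , G} l → eq q G (ℕₚ.<⇒≤ l) }) (D⁺-deg-< η))))) ⟩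
    _ ∎
    where
    step : Word × Mono → Hf
    step (q , G) = antipodeTree (deg η) (rct i q) *H ((1# , G) ∷ [])
    eq : ∀ q G → deg q ≤ deg η → ∫ (step (q , G)) φ ≈ ∫S (rct i q ∷ []) (λ A → φ (A ++ G))
    eq q G l = begin
      ∫ (step (q , G)) φ
        ≈⟨ ∫-*H (antipodeTree (deg η) (rct i q)) ((1# , G) ∷ []) φ ⟩
      ∫ (antipodeTree (deg η) (rct i q)) (λ A → ∫ ((1# , G) ∷ []) (λ B → φ (A ++ B)))
        ≈⟨ ∫-cong (antipodeTree (deg η) (rct i q)) (λ A → ∫-pure G (λ B → φ (A ++ B))) ⟩
      ∫ (antipodeTree (deg η) (rct i q)) (λ A → φ (A ++ G))
        ≡⟨ cong (λ p → ∫ p (λ A → φ (A ++ G))) (antipodeTree-fuel (deg η) (deg q) i q l ℕₚ.≤-refl) ⟩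
      ∫S₁ (rct i q) (λ A → φ (A ++ G))
        ≈⟨ ∫S-singleton (rct i q) _ ⟨
      _ ∎

  ∫S-++ : ∀ M N φ → ∫S (M ++ N) φ ≈ ∫S M (λ A → ∫S N (λ B → φ (A ++ B)))
  ∫S-++ []      N φ = sym (∫S-[] λ A → ∫S N (λ B → φ (A ++ B)))
  ∫S-++ (t ∷ M) N φ = begin
    _ ≈⟨ ∫S-∷ t (M ++ N) φ ⟩
    _ ≈⟨ ∫-cong (antipodeTree (degRCT t) t) (λ A → ∫S-++ M N _) ⟩
    _ ≈⟨ ∫-cong (antipodeTree (degRCT t) t) (λ A → ∫S-cong M λ B → ∫S-cong N λ C → reflexive (cong φ (++-assoc A B C))) ⟨
    _ ≈⟨ ∫S-∷ t M _ ⟨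
    _ ∎

  ∫S-↭ : ∀ {M N} → M ↭ N → ∀ φ → Respects₁ φ → ∫S M φ ≈ ∫S N φ
  ∫S-↭ ↭.refl φ r = refl
  ∫S-↭ (prep {M} {N} t p) φ r = trans (∫S-∷ t M φ)
    (trans (∫-cong (antipodeTree (degRCT t) t) λ A → ∫S-↭ p _ (λ q → r (++⁺ˡ A q))) (sym (∫S-∷ t N φ)))
  ∫S-↭ (swap {M} {N} t u p) φ r = begin
    _ ≈⟨ two t u M ⟩
    _ ≈⟨ ∫-cong (antipodeTree (degRCT t) t) (λ A → ∫-cong (antipodeTree (degRCT u) u) λ B → trans
           (∫S-↭ p _ (λ q → r (++⁺ˡ A (++⁺ˡ B q)))) (∫S-cong N λ C → r (shifts A B))) ⟩
    _ ≈⟨ ∫-swap (antipodeTree (degRCT t) t) (antipodeTree (degRCT u) u) _ ⟩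
    _ ≈⟨ two u t N ⟨
    _ ∎
    where
    two : ∀ t u M → ∫S (t ∷ u ∷ M) φ ≈ ∫S₁ t (λ A → ∫S₁ u (λ B → ∫S M (λ C → φ (A ++ (B ++ C)))))
    two t u M = trans (∫S-∷ t (u ∷ M) φ) (∫-cong (antipodeTree (degRCT t) t) λ A → ∫S-∷ u M _)
  ∫S-↭ (↭.trans p q) φ r = trans (∫S-↭ p φ r) (∫S-↭ q φ r)

  ∫S*id ∫id*S : Mono → (Mono → K) → K
  ∫S*id M φ = ∫Δ M (λ A B → ∫S A (λ A′ → φ (A′ ++ B)))
  ∫id*S M φ = ∫Δ M (λ A B → ∫S B (λ B′ → φ (A ++ B′)))

  ∫S*id₁ ∫id*S₁ : RCT → (Mono → K) → K
  ∫S*id₁ t φ = ∫Δ₁ t (λ A B → ∫S A (λ A′ → φ (A′ ++ B)))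
  ∫id*S₁ t φ = ∫Δ₁ t (λ A B → ∫S B (λ B′ → φ (A ++ B′)))

  -- The convolution of two algebra morphisms into a commutative algebra is again multiplicative.
  -- The interchange of the four factors uses commutativity.
  ∫S*id-∷ : ∀ t M φ → Respects₁ φ → ∫S*id (t ∷ M) φ ≈ ∫S*id₁ t (λ X → ∫S*id M (λ Y → φ (X ++ Y)))
  ∫S*id-∷ t M φ r = begin
    _ ≈⟨ ∫Δ-∷ t M _ ⟩
    _ ≈⟨ ∫Δ₁-cong t (λ A A′ → ∫Δ-cong M λ B B′ → trans (∫S-++ A B _)
           (∫S-cong A λ C → ∫S-cong B λ C′ → r (++-interchange C C′ A′ B′))) ⟩
    _ ≈⟨ ∫Δ₁-cong t (λ A A′ → ∫-swap (ΔMono M) (antipodeMono A) _) ⟩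
    _ ∎

  ∫id*S-∷ : ∀ t M φ → Respects₁ φ → ∫id*S (t ∷ M) φ ≈ ∫id*S₁ t (λ X → ∫id*S M (λ Y → φ (X ++ Y)))
  ∫id*S-∷ t M φ r = begin
    _ ≈⟨ ∫Δ-∷ t M _ ⟩
    _ ≈⟨ ∫Δ₁-cong t (λ A A′ → ∫Δ-cong M λ B B′ → trans (∫S-++ A′ B′ _)
           (∫S-cong A′ λ C → ∫S-cong B′ λ C′ → r (++-interchange A B C C′))) ⟩
    _ ≈⟨ ∫Δ₁-cong t (λ A A′ → ∫-swap (ΔMono M) (antipodeMono A′) _) ⟩
    _ ∎

  ∫S*id₁≈0 : ∀ t φ → ∫S*id₁ t φ ≈ 0#
  ∫S*id₁≈0 (rct i η) φ = begin
    _ ≈⟨ ∫Δ₁-expand i η _ ⟩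
    ∫S [] (λ A → φ (A ++ t ∷ [])) + (∫S (t ∷ []) (λ A → φ (A ++ [])) + rest)
      ≈⟨ +-cong (∫S-[] λ A → φ (A ++ t ∷ [])) (+-congʳ (trans (∫S-singleton t _)
           (trans (∫-cong (antipodeTree (deg η) t) λ A → reflexive (cong φ (++-identityʳ A))) (∫S₁-recursion i η φ)))) ⟩
    φ (t ∷ []) + (- (φ (t ∷ []) + rest) + rest)
      ≈⟨ +-congˡ (+-comm _ _) ⟩
    φ (t ∷ []) + (rest + - (φ (t ∷ []) + rest))
      ≈⟨ +-assoc _ _ _ ⟨
    (φ (t ∷ []) + rest) + - (φ (t ∷ []) + rest)
      ≈⟨ -‿inverseʳ _ ⟩
    0# ∎
    where
    t = rct i η
    rest = ∑ (D⁺ η) (λ (q , G) → ∫S (rct i q ∷ []) (λ A → φ (A ++ G)))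

  ∫S*id≈ε : ∀ M φ → Respects₁ φ → ∫S*id M φ ≈ εMono M * φ []
  ∫S*id≈ε []      φ r = trans (∫Δ-[] λ A B → ∫S A (λ A′ → φ (A′ ++ B)))
    (trans (∫S-[] λ A → φ (A ++ [])) (sym (*-identityˡ _)))
  ∫S*id≈ε (t ∷ M) φ r = trans (∫S*id-∷ t M φ r) (trans (∫S*id₁≈0 t (λ X → ∫S*id M (λ Y → φ (X ++ Y)))) (sym (zeroˡ _)))

  ∫id*S₁≈0 : ∀ n i η → deg η ≤ n → ∀ φ → Respects₁ φ → ∫id*S₁ (rct i η) φ ≈ 0#
  ∫id*S₁≈0 zero    i η l φ r = case ℕₚ.≤-trans (deg≥1 η) l of λ ()
  -- It suffices to show S(t) = (id * S)(t) + S(t), since addition can be cancelled.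
  ∫id*S₁≈0 (suc n) i η l φ r = +-identityˡ-unique _ _ (sym (begin
    ∫S (t ∷ []) φ
      ≈⟨ left ⟨
    ∫Δ₁ t (λ A B → ∫Δ A (λ A₁ A₂ → χ A₁ A₂ B))
      ≈⟨ ∫Δ₁-coassoc t χ χ-respects ⟩
    ∫Δ₁ t (λ A B → ∫Δ B (χ A))
      ≈⟨ ∫Δ₁-expand i η _ ⟩
    ∫Δ (t ∷ []) (χ []) + (∫Δ [] (χ (t ∷ [])) + ∑ (D⁺ η) (λ (q , G) → ∫Δ G (χ (rct i q ∷ []))))
      ≈⟨ +-cong (trans (∫Δ-singleton t (χ []))
                       (∫Δ₁-cong t λ B C → ∫S-[] λ A → ∫S C (λ C′ → φ (A ++ (B ++ C′)))))
                (+-cong (trans (∫Δ-[] (χ (t ∷ []))) (∫S-cong (t ∷ []) λ A →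
                          trans (∫S-[] λ C → φ (A ++ C)) (reflexive (cong φ (++-identityʳ A)))))
                        (trans (∑-cong-All (D⁺ η) smaller) (∑-ε (D⁺ η)))) ⟩
    ∫id*S₁ t φ + (∫S (t ∷ []) φ + 0#)
      ≈⟨ +-congˡ (+-identityʳ _) ⟩
    ∫id*S₁ t φ + ∫S (t ∷ []) φ ∎))
    where
    t = rct i η
    -- The triple convolution S * id * S before the coproducts are inserted; coassociativity at χ is
    -- the associativity of convolution.
    χ : Mono → Mono → Mono → K
    χ A B C = ∫S A (λ A′ → ∫S C (λ C′ → φ (A′ ++ (B ++ C′))))
    χ-respects : Respects₃ χ
    χ-respects {A} {A′} {B} {B′} {C} {C′} p q s = trans
      (∫S-↭ p _ (λ p′ → ∫S-cong C λ _ → r (++⁺ʳ _ p′)))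
      (∫S-cong A′ λ X → trans (∫S-↭ s _ (λ s′ → r (++⁺ˡ X (++⁺ˡ B s′))))
                              (∫S-cong C′ λ Y → r (++⁺ˡ X (++⁺ʳ Y q))))
    left : ∫Δ₁ t (λ A B → ∫Δ A (λ A₁ A₂ → χ A₁ A₂ B)) ≈ ∫S (t ∷ []) φ
    left = begin
      _ ≈⟨ ∫Δ₁-cong t (λ A B → ∫Δ-cong A λ A₁ A₂ → ∫S-cong A₁ λ X → ∫S-cong B λ Y →
             reflexive (cong φ (++-assoc X A₂ Y))) ⟨
      ∫Δ₁ t (λ A B → ∫S*id A (λ X → ∫S B (λ Y → φ (X ++ Y))))
        ≈⟨ ∫Δ₁-cong t (λ A B → ∫S*id≈ε A _ (λ p → ∫S-cong B λ Y → r (++⁺ʳ Y p))) ⟩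
      ∫Δ₁ t (λ A B → εMono A * ∫S B φ)
        ≈⟨ ∫Δ₁-expand i η _ ⟩
      1# * ∫S (t ∷ []) φ + ∑ (D η) (λ (q , G) → 0# * ∫S G φ)
        ≈⟨ +-cong (*-identityˡ _) (trans (∑-cong (D η) λ _ → zeroˡ _) (∑-ε (D η))) ⟩
      ∫S (t ∷ []) φ + 0#
        ≈⟨ +-identityʳ _ ⟩
      ∫S (t ∷ []) φ ∎
    -- G is nonempty and id * S is multiplicative, so it is enough that id * S vanishes at the head
    -- of G. The quotient takes up at least one unit of degree, hence that head has degree less than
    -- `deg η`.
    smaller : All (λ (q , G) → ∫Δ G (χ (rct i q ∷ [])) ≈ 0#) (D⁺ η)
    smaller = All.map (λ { {q , rct j θ ∷ G} (e , _) → trans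
        (∫-swap (ΔMono (rct j θ ∷ G)) (antipodeMono (rct i q ∷ [])) _)
        (trans (∫S-cong (rct i q ∷ []) λ X → trans
          (∫id*S-∷ (rct j θ) G (λ Y → φ (X ++ Y)) (λ p → r (++⁺ˡ X p)))
          (∫id*S₁≈0 n j θ (bound q θ (degMono G) e) _ (λ p → ∫Δ-cong G λ A B → ∫S-cong B λ B′ → r (++⁺ˡ X (++⁺ʳ (A ++ B′) p)))))
        (∫-0 (antipodeMono (rct i q ∷ [])))) })
      (All.zip (extract⁺-deg (length η) η , extract⁺-nonempty (length η) η))
      where
      bound : ∀ q θ d → deg q +ℕ (deg θ +ℕ d) ≡ deg η → deg θ ≤ n
      bound q θ d e = ℕₚ.≤-pred (ℕₚ.≤-trans (≡.subst (deg θ <_) e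
        (ℕₚ.≤-trans (s≤s (ℕₚ.m≤m+n (deg θ) d)) (ℕₚ.+-monoˡ-≤ (deg θ +ℕ d) (deg≥1 q)))) l)

  ∫id*S≈ε : ∀ M φ → Respects₁ φ → ∫id*S M φ ≈ εMono M * φ []
  ∫id*S≈ε []      φ r = trans (∫Δ-[] λ A B → ∫S B (λ B′ → φ (A ++ B′))) (trans (∫S-[] φ) (sym (*-identityˡ _)))
  ∫id*S≈ε (rct i η ∷ M) φ r = trans (∫id*S-∷ (rct i η) M φ r)
    (trans (∫id*S₁≈0 (deg η) i η ℕₚ.≤-refl _ (λ p → ∫Δ-cong M λ A B → ∫S-cong B λ B′ → r (++⁺ʳ (A ++ B′) p))) (sym (zeroˡ _)))

-- The Hopf algebra

module Grading {c ℓ : Level} (F : CharZeroField c ℓ) (m : ℕ) where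
  open CharZeroField F using (commRing)
  open CommutativeRing commRing using (_*_; 1#)
  open RCTHopf F m renaming (_≈_ to _≈H_; ε to εH)
  open Extraction F m
  open ListSum (×-commutativeMonoid equivalence 0ℓ)
  open LabelSums F m (×-commutativeMonoid equivalence 0ℓ) using (∑-ΔRCTterms)
  open +-*-Solver using (solve; _:+_; _:=_)

  ∑⇒All : ∀ {A : Set} {P : A → Set} xs → ∑ xs P → All P xs
  ∑⇒All []       _        = []
  ∑⇒All (x ∷ xs) (p , ps) = p ∷ ∑⇒All xs ps

  All⇒∑ : ∀ {A : Set} {P : A → Set} {xs} → All P xs → ∑ xs P
  All⇒∑ []       = _
  All⇒∑ (p ∷ ps) = p , All⇒∑ ps

  degMono-++ : ∀ M N → degMono (M ++ N) ≡ degMono M +ℕ degMono N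
  degMono-++ []      N = ≡.refl
  degMono-++ (t ∷ M) N = ≡.trans (cong (degRCT t +ℕ_) (degMono-++ M N)) (≡.sym (ℕₚ.+-assoc (degRCT t) _ _))

  -- Here `∑` takes values in types, with product as the operation and logical equivalence as
  -- equality. A sum is then a conjunction, and `∑-ΔRCTterms` transports homogeneity from the
  -- recursive extraction to the labellings.
  ΔRCT-graded : ∀ t → All (λ (a , A , B) → degMono A +ℕ degMono B ≡ degRCT t) (ΔRCT t)
  ΔRCT-graded (rct i η) = Allₚ.map⁺ (∑⇒All (ΔRCTterms (rct i η)) (Equivalence.from
    (∑-ΔRCTterms i η (λ (A , B) → degMono A +ℕ degMono B ≡ deg η))
    (ℕₚ.+-identityʳ (deg η) , All⇒∑ (All.map (λ { {q , G} e →
      ≡.trans (cong (_+ℕ degMono G) (ℕₚ.+-identityʳ (deg q))) e }) (D-deg η)))))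

  ΔMono-graded : ∀ M → All (λ (a , A , B) → degMono A +ℕ degMono B ≡ degMono M) (ΔMono M)
  ΔMono-graded []      = ≡.refl ∷ []
  ΔMono-graded (t ∷ M) = All-concatMap⁺ (All.map (λ { {a , A , A′} e → Allₚ.map⁺
    (All.map (λ { {b , B , B′} e′ → ≡.trans (cong₂ _+ℕ_ (degMono-++ A B) (degMono-++ A′ B′))
      (≡.trans (solve 4 (λ x y z w → (x :+ y) :+ (z :+ w) := (x :+ z) :+ (y :+ w)) ≡.refl
                 (degMono A) (degMono B) (degMono A′) (degMono B′))
               (cong₂ _+ℕ_ e e′)) }) (ΔMono-graded M)) }) (ΔRCT-graded t))

module HopfAlgebra {c ℓ : Level} (F : CharZeroField c ℓ) (m : ℕ) where
  open CharZeroField F using (commRing)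
  open CommutativeRing commRing renaming (Carrier to K)
  open RCTHopf F m renaming (_≈_ to _≈H_; ε to εH)
  open Extraction F m
  open MonoEquality F m
  open Coproduct F m
  open Antipode F m
  open Grading F m
  open ListSum +-commutativeMonoid
  open Integral commRing
  open import Relation.Binary.Reasoning.Setoid setoid

  _↭²_ : Mono × Mono → Mono × Mono → Set
  _↭²_ = Pointwise _↭_ _↭_

  _↭³_ : Mono × Mono × Mono → Mono × Mono × Mono → Set
  _↭³_ = Pointwise _↭_ _↭²_

  eqMono²⇒↭² : ∀ {x y} → eqMono² x y ≡ true → x ↭² y
  eqMono²⇒↭² {A , B} {A′ , B′} e with ∧-≡true {eqMono A A′} e
  ... | p , q = eqMono⇒↭ p , eqMono⇒↭ q

  ↭²⇒eqMono² : ∀ {x y} → x ↭² y → eqMono² x y ≡ true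
  ↭²⇒eqMono² (p , q) = cong₂ _∧_ (↭⇒eqMono p) (↭⇒eqMono q)

  eqMono³⇒↭³ : ∀ {x y} → eqMono³ x y ≡ true → x ↭³ y
  eqMono³⇒↭³ {A , B , C} {A′ , B′ , C′} e with ∧-≡true {eqMono A A′} e
  ... | p , q = eqMono⇒↭ p , eqMono²⇒↭² {B , C} {B′ , C′} q

  ↭³⇒eqMono³ : ∀ {x y} → x ↭³ y → eqMono³ x y ≡ true
  ↭³⇒eqMono³ (p , q) = cong₂ _∧_ (↭⇒eqMono p) (↭²⇒eqMono² q)

  ↭²-isEquivalence : IsEquivalence _↭²_
  ↭²-isEquivalence = ×-isEquivalence ↭-isEquivalence ↭-isEquivalence

  module L¹ = FreeModule F m Mono eqMono _↭_ ↭-isEquivalence eqMono⇒↭ ↭⇒eqMono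
  module L² = FreeModule F m (Mono × Mono) eqMono² _↭²_ ↭²-isEquivalence
    (λ {x} {y} → eqMono²⇒↭² {x} {y}) ↭²⇒eqMono²
  module L³ = FreeModule F m (Mono × Mono × Mono) eqMono³ _↭³_ (×-isEquivalence ↭-isEquivalence ↭²-isEquivalence)
    (λ {x} {y} → eqMono³⇒↭³ {x} {y}) ↭³⇒eqMono³

  ≈H-isEquivalence : IsEquivalence _≈H_
  ≈H-isEquivalence = record
    { refl  = λ b → refl
    ; sym   = λ e b → sym (e b)
    ; trans = λ e e′ b → trans (e b) (e′ b)
    }

  ∫-cong-≈H : ∀ {p q φ} → p ≈H q → Respects₁ φ → ∫ p φ ≈ ∫ q φ
  ∫-cong-≈H {p} {q} {φ} e r = L¹.≈L⇒∫≈ p q e φ r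

  Hf-isCommutativeRing : IsCommutativeRing _≈H_ _+H_ _*H_ -H_ 0H 1H
  Hf-isCommutativeRing = record
    { isRing = record
      { +-isAbelianGroup = record
        { isGroup = record
          { isMonoid = record
            { isSemigroup = record
              { isMagma = record
                { isEquivalence = ≈H-isEquivalence
                ; ∙-cong = λ {p} {q} {p′} {q′} e e′ b → begin
                    _ ≈⟨ L¹.coeff-++ p p′ b ⟩
                    _ ≈⟨ +-cong (e b) (e′ b) ⟩
                    _ ≈⟨ L¹.coeff-++ q q′ b ⟨
                    _ ∎
                }
              ; assoc = λ p q s b → reflexive (cong (λ z → H.coeff z b) (++-assoc p q s))
              }
            ; identity = (λ p b → refl) , λ p b → reflexive (cong (λ z → H.coeff z b) (++-identityʳ p))
            }
          ; inverse = (λ p b → trans (L¹.coeff-++ (-H p) p b) (trans (+-congʳ (L¹.coeff-negL p b)) (-‿inverseˡ _)))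
                    , (λ p b → trans (L¹.coeff-++ p (-H p) b) (trans (+-congˡ (L¹.coeff-negL p b)) (-‿inverseʳ _)))
          ; ⁻¹-cong = λ {p} {q} e b → trans (L¹.coeff-negL p b) (trans (-‿cong (e b)) (sym (L¹.coeff-negL q b)))
          }
        ; comm = λ p q b → trans (L¹.coeff-++ p q b) (trans (+-comm _ _) (sym (L¹.coeff-++ q p b)))
        }
      ; *-cong = λ {p} {p′} {q} {q′} e e′ → L¹.∫≈⇒≈L (p *H q) (p′ *H q′) λ φ r → begin
          _ ≈⟨ ∫-*H p q φ ⟩
          _ ≈⟨ ∫-cong p (λ M → ∫-cong-≈H {q} {q′} e′ (λ s → r (++⁺ˡ M s))) ⟩
          _ ≈⟨ ∫-cong-≈H {p} {p′} e (λ s → ∫-cong q′ λ N → r (++⁺ʳ N s)) ⟩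
          _ ≈⟨ ∫-*H p′ q′ φ ⟨
          _ ∎
      ; *-assoc = λ p q s → L¹.∫≈⇒≈L ((p *H q) *H s) (p *H (q *H s)) λ φ r → begin
          _ ≈⟨ ∫-*H (p *H q) s φ ⟩
          _ ≈⟨ ∫-*H p q _ ⟩
          _ ≈⟨ ∫-cong p (λ M → ∫-cong q λ N → ∫-cong s λ O → reflexive (cong φ (++-assoc M N O))) ⟩
          _ ≈⟨ ∫-cong p (λ M → ∫-*H q s _) ⟨
          _ ≈⟨ ∫-*H p (q *H s) φ ⟨
          _ ∎
      ; *-identity =
          (λ p → L¹.∫≈⇒≈L (1H *H p) p λ φ r → trans (∫-*H 1H p φ) (∫-pure [] (λ M → ∫ p (λ N → φ (M ++ N)))))
        , (λ p → L¹.∫≈⇒≈L (p *H 1H) p λ φ r → trans (∫-*H p 1H φ) (∫-cong p λ M →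
             trans (∫-pure [] (λ N → φ (M ++ N))) (reflexive (cong φ (++-identityʳ M)))))
      ; distrib =
          (λ p q s → L¹.∫≈⇒≈L (p *H (q +H s)) ((p *H q) +H (p *H s)) λ φ r → begin
            _ ≈⟨ ∫-*H p (q +H s) φ ⟩
            _ ≈⟨ ∫-cong p (λ M → ∫-++ q s _) ⟩
            _ ≈⟨ ∫-+ p _ _ ⟩
            _ ≈⟨ +-cong (∫-*H p q φ) (∫-*H p s φ) ⟨
            _ ≈⟨ ∫-++ (p *H q) (p *H s) φ ⟨
            _ ∎)
        , (λ p q s → L¹.∫≈⇒≈L ((q +H s) *H p) ((q *H p) +H (s *H p)) λ φ r → begin
            _ ≈⟨ ∫-*H (q +H s) p φ ⟩
            _ ≈⟨ ∫-++ q s _ ⟩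
            _ ≈⟨ +-cong (∫-*H q p φ) (∫-*H s p φ) ⟨
            _ ≈⟨ ∫-++ (q *H p) (s *H p) φ ⟨
            _ ∎)
      }
    ; *-comm = λ p q → L¹.∫≈⇒≈L (p *H q) (q *H p) λ φ r → begin
        _ ≈⟨ ∫-*H p q φ ⟩
        _ ≈⟨ ∫-cong p (λ M → ∫-cong q λ N → r (++-comm M N)) ⟩
        _ ≈⟨ ∫-swap p q _ ⟩
        _ ≈⟨ ∫-*H q p φ ⟨
        _ ∎
    }

  ∫-Δ : ∀ p (φ : Mono × Mono → K) → ∫ (Δ p) φ ≈ ∫ p (λ M → ∫ (ΔMono M) φ)
  ∫-Δ p φ = ∫-concatMap _ p φ _ (λ k M → ∫-scaleMap k id (ΔMono M) φ)

  ∫-scale² : ∀ a p (φ : Mono × Mono → K) → ∫ (H².scale a p) φ ≈ a * ∫ p φ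
  ∫-scale² a p φ = ∫-scaleMap a id p φ

  ε≈∫ : ∀ p → εH p ≈ ∫ p εMono
  ε≈∫ []            = refl
  ε≈∫ ((a , M) ∷ p) = +-congˡ (ε≈∫ p)

  εMono-++ : ∀ M N → εMono (M ++ N) ≈ εMono M * εMono N
  εMono-++ []      N = sym (*-identityˡ _)
  εMono-++ (t ∷ M) N = sym (zeroˡ _)

  εMono-respects : Respects₁ εMono
  εMono-respects {[]}    {[]}    p = refl
  εMono-respects {_ ∷ _} {_ ∷ _} p = refl
  εMono-respects {[]}    {_ ∷ _} p = case ↭-empty-inv (↭-sym p) of λ ()
  εMono-respects {_ ∷ _} {[]}    p = case ↭-empty-inv p of λ ()

  ∫Δ-counitˡ : ∀ M φ → ∫Δ M (λ A B → εMono A * φ B) ≈ φ M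
  ∫Δ-counitˡ []            φ = trans (∫Δ-[] λ A B → εMono A * φ B) (*-identityˡ _)
  ∫Δ-counitˡ (rct i η ∷ M) φ = begin
    _ ≈⟨ ∫Δ-∷ (rct i η) M _ ⟩
    _ ≈⟨ ∫Δ₁-expand i η _ ⟩
    _ ≈⟨ +-cong (∫Δ-counitˡ M (λ B → φ (rct i η ∷ B)))
                (∑-cong (D η) λ _ → trans (∫Δ-cong M λ A B → zeroˡ _) (∫-0 (ΔMono M))) ⟩
    φ (rct i η ∷ M) + ∑ (D η) (λ _ → 0#)
      ≈⟨ trans (+-congˡ (∑-ε (D η))) (+-identityʳ _) ⟩
    φ (rct i η ∷ M) ∎

  -- At each tree only the term with the empty extraction survives: a nonempty extraction puts at
  -- least one tree in the right factor.
  ∫Δ-counitʳ : ∀ M φ → ∫Δ M (λ A B → εMono B * φ A) ≈ φ M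
  ∫Δ-counitʳ []            φ = trans (∫Δ-[] λ A B → εMono B * φ A) (*-identityˡ _)
  ∫Δ-counitʳ (rct i η ∷ M) φ = begin
    _ ≈⟨ ∫Δ-∷ (rct i η) M _ ⟩
    _ ≈⟨ ∫Δ₁-expand i η _ ⟩
    _ ≈⟨ +-cong (trans (∫Δ-cong M λ A B → zeroˡ _) (∫-0 (ΔMono M)))
          (+-cong (∫Δ-counitʳ M (λ A → φ (rct i η ∷ A)))
             (∑-cong-All (D⁺ η) (All.map (λ { {q , _ ∷ G} _ → trans (∫Δ-cong M λ A B → zeroˡ _) (∫-0 (ΔMono M)) })
               (extract⁺-nonempty (length η) η)))) ⟩
    0# + (φ (rct i η ∷ M) + ∑ (D⁺ η) (λ _ → 0#))
      ≈⟨ trans (+-identityˡ _) (trans (+-congˡ (∑-ε (D⁺ η))) (+-identityʳ _)) ⟩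
    φ (rct i η ∷ M) ∎

  ∫-Δ⊗id : ∀ p (φ : Mono × Mono × Mono → K) →
    ∫ (Δ⊗id p) φ ≈ ∫ p (λ (M , N) → ∫Δ M (λ A B → φ (A , B , N)))
  ∫-Δ⊗id p φ = ∫-concatMap _ p φ _ (λ k (M , N) → ∫-scaleMap k (λ (A , B) → (A , B , N)) (ΔMono M) φ)

  ∫-id⊗Δ : ∀ p (φ : Mono × Mono × Mono → K) →
    ∫ (id⊗Δ p) φ ≈ ∫ p (λ (M , N) → ∫Δ N (λ A B → φ (M , A , B)))
  ∫-id⊗Δ p φ = ∫-concatMap _ p φ _ (λ k (M , N) → ∫-scaleMap k (λ (A , B) → (M , A , B)) (ΔMono N) φ)

  ∫-ε⊗id : ∀ p (φ : Mono → K) → ∫ (ε⊗id p) φ ≈ ∫ p (λ (M , N) → εMono M * φ N)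
  ∫-ε⊗id p φ = trans (∑-map _ p _) (∑-cong p λ _ → *-assoc _ _ _)

  ∫-id⊗ε : ∀ p (φ : Mono → K) → ∫ (id⊗ε p) φ ≈ ∫ p (λ (M , N) → εMono N * φ M)
  ∫-id⊗ε p φ = trans (∑-map _ p _) (∑-cong p λ _ → *-assoc _ _ _)

  antipode : Hf → Hf
  antipode = concatMap (λ (a , M) → H.scale a (antipodeMono M))

  ∫-antipode : ∀ p φ → ∫ (antipode p) φ ≈ ∫ p (λ M → ∫S M φ)
  ∫-antipode p φ = ∫-concatMap _ p φ _ (λ k M → ∫-scale k (antipodeMono M) φ)

  antipode-linear : IsLinear antipode
  antipode-linear =
      (λ p q e → L¹.∫≈⇒≈L (antipode p) (antipode q) λ φ r → begin
        _ ≈⟨ ∫-antipode p φ ⟩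
        _ ≈⟨ ∫-cong-≈H {p} {q} e (λ s → ∫S-↭ s φ r) ⟩
        _ ≈⟨ ∫-antipode q φ ⟨
        _ ∎)
    , (λ p q → L¹.∫≈⇒≈L (antipode (p +H q)) (antipode p +H antipode q) λ φ r → begin
        _ ≈⟨ ∫-antipode (p +H q) φ ⟩
        _ ≈⟨ ∫-++ p q _ ⟩
        _ ≈⟨ +-cong (∫-antipode p φ) (∫-antipode q φ) ⟨
        _ ≈⟨ ∫-++ (antipode p) (antipode q) φ ⟨
        _ ∎)
    , (λ a p → L¹.∫≈⇒≈L (antipode (H.scale a p)) (H.scale a (antipode p)) λ φ r → begin
        _ ≈⟨ ∫-antipode (H.scale a p) φ ⟩
        _ ≈⟨ ∫-scale a p _ ⟩
        _ ≈⟨ *-congˡ (∫-antipode p φ) ⟨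
        _ ≈⟨ ∫-scale a (antipode p) φ ⟨
        _ ∎)

  ∫-ηε : ∀ p φ → ∫ (ηε p) φ ≈ ∫ p (λ M → εMono M * φ [])
  ∫-ηε p φ = begin
    εH p * φ [] + 0#               ≈⟨ trans (+-identityʳ _) (trans (*-congʳ (ε≈∫ p)) (*-comm _ _)) ⟩
    φ [] * ∫ p εMono               ≈⟨ ∫-*ˡ p (φ []) εMono ⟨
    ∫ p (λ M → φ [] * εMono M)     ≈⟨ ∫-cong p (λ M → *-comm _ _) ⟩
    ∫ p (λ M → εMono M * φ [])     ∎

  antipodeˡ : ∀ p → m∘S⊗id antipode (Δ p) ≈H ηε p
  antipodeˡ p = L¹.∫≈⇒≈L (m∘S⊗id antipode (Δ p)) (ηε p) λ φ r → begin
    _ ≈⟨ ∫-concatMap _ (Δ p) φ (λ (M , N) → ∫S M (λ A → φ (A ++ N))) (λ k (M , N) → begin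
           _ ≈⟨ ∫-scale k (antipode ((1# , M) ∷ []) *H ((1# , N) ∷ [])) φ ⟩
           _ ≈⟨ *-congˡ (∫-*H (antipode ((1# , M) ∷ [])) ((1# , N) ∷ []) φ) ⟩
           _ ≈⟨ *-congˡ (∫-antipode ((1# , M) ∷ []) _) ⟩
           _ ≈⟨ *-congˡ (∫-pure M (λ M′ → ∫S M′ (λ A → ∫ ((1# , N) ∷ []) (λ B → φ (A ++ B))))) ⟩
           _ ≈⟨ *-congˡ (∫S-cong M λ A → ∫-pure N (λ B → φ (A ++ B))) ⟩
           _ ∎) ⟩
    _ ≈⟨ ∫-Δ p _ ⟩
    _ ≈⟨ ∫-cong p (λ M → ∫S*id≈ε M φ r) ⟩
    _ ≈⟨ ∫-ηε p φ ⟨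
    _ ∎

  antipodeʳ : ∀ p → m∘id⊗S antipode (Δ p) ≈H ηε p
  antipodeʳ p = L¹.∫≈⇒≈L (m∘id⊗S antipode (Δ p)) (ηε p) λ φ r → begin
    _ ≈⟨ ∫-concatMap _ (Δ p) φ (λ (M , N) → ∫S N (λ B → φ (M ++ B))) (λ k (M , N) → begin
           _ ≈⟨ ∫-scale k (((1# , M) ∷ []) *H antipode ((1# , N) ∷ [])) φ ⟩
           _ ≈⟨ *-congˡ (∫-*H ((1# , M) ∷ []) (antipode ((1# , N) ∷ [])) φ) ⟩
           _ ≈⟨ *-congˡ (∫-pure M (λ A → ∫ (antipode ((1# , N) ∷ [])) (λ B → φ (A ++ B)))) ⟩
           _ ≈⟨ *-congˡ (∫-antipode ((1# , N) ∷ []) _) ⟩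
           _ ≈⟨ *-congˡ (∫-pure N (λ N′ → ∫S N′ (λ B → φ (M ++ B)))) ⟩
           _ ∎) ⟩
    _ ≈⟨ ∫-Δ p _ ⟩
    _ ≈⟨ ∫-cong p (λ M → ∫id*S≈ε M φ r) ⟩
    _ ≈⟨ ∫-ηε p φ ⟨
    _ ∎

  hopf : IsConnectedGradedCommHopf
  hopf = record
    { isCommRing = Hf-isCommutativeRing
    ; scale-cong = λ a b p q a≈b e → L¹.∫≈⇒≈L (H.scale a p) (H.scale b q) λ φ r → begin
        _ ≈⟨ ∫-scale a p φ ⟩
        _ ≈⟨ *-cong a≈b (∫-cong-≈H {p} {q} e r) ⟩
        _ ≈⟨ ∫-scale b q φ ⟨
        _ ∎
    ; scale-+ˡ = λ a b p → L¹.∫≈⇒≈L (H.scale (a + b) p) (H.scale a p +H H.scale b p) λ φ r → begin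
        _ ≈⟨ ∫-scale (a + b) p φ ⟩
        _ ≈⟨ distribʳ _ _ _ ⟩
        _ ≈⟨ +-cong (∫-scale a p φ) (∫-scale b p φ) ⟨
        _ ≈⟨ ∫-++ (H.scale a p) (H.scale b p) φ ⟨
        _ ∎
    ; scale-+ʳ = λ a p q → L¹.∫≈⇒≈L (H.scale a (p +H q)) (H.scale a p +H H.scale a q) λ φ r → begin
        _ ≈⟨ ∫-scale a (p +H q) φ ⟩
        _ ≈⟨ *-congˡ (∫-++ p q φ) ⟩
        _ ≈⟨ distribˡ _ _ _ ⟩
        _ ≈⟨ +-cong (∫-scale a p φ) (∫-scale a q φ) ⟨
        _ ≈⟨ ∫-++ (H.scale a p) (H.scale a q) φ ⟨
        _ ∎
    ; scale-* = λ a b p → L¹.∫≈⇒≈L (H.scale (a * b) p) (H.scale a (H.scale b p)) λ φ r → begin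
        _ ≈⟨ ∫-scale (a * b) p φ ⟩
        _ ≈⟨ *-assoc _ _ _ ⟩
        _ ≈⟨ *-congˡ (∫-scale b p φ) ⟨
        _ ≈⟨ ∫-scale a (H.scale b p) φ ⟨
        _ ∎
    ; scale-1 = λ p → L¹.∫≈⇒≈L (H.scale 1# p) p λ φ r → trans (∫-scale 1# p φ) (*-identityˡ _)
    ; scale-*H = λ a p q → L¹.∫≈⇒≈L (H.scale a (p *H q)) (H.scale a p *H q) λ φ r → begin
        _ ≈⟨ ∫-scale a (p *H q) φ ⟩
        _ ≈⟨ *-congˡ (∫-*H p q φ) ⟩
        _ ≈⟨ ∫-scale a p _ ⟨
        _ ≈⟨ ∫-*H (H.scale a p) q φ ⟨
        _ ∎
    ; Δ-cong = λ p q e → L².∫≈⇒≈L (Δ p) (Δ q) λ φ r → begin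
        _ ≈⟨ ∫-Δ p φ ⟩
        _ ≈⟨ ∫-cong-≈H {p} {q} e (λ s → ∫Δ-↭ s (λ A B → φ (A , B)) (λ s s′ → r (s , s′))) ⟩
        _ ≈⟨ ∫-Δ q φ ⟨
        _ ∎
    ; Δ-+ = λ p q → L².∫≈⇒≈L (Δ (p +H q)) (Δ p ++ Δ q) λ φ r → begin
        _ ≈⟨ ∫-Δ (p +H q) φ ⟩
        _ ≈⟨ ∫-++ p q _ ⟩
        _ ≈⟨ +-cong (∫-Δ p φ) (∫-Δ q φ) ⟨
        _ ≈⟨ ∫-++ (Δ p) (Δ q) φ ⟨
        _ ∎
    ; Δ-scale = λ a p → L².∫≈⇒≈L (Δ (H.scale a p)) (H².scale a (Δ p)) λ φ r → begin
        _ ≈⟨ ∫-Δ (H.scale a p) φ ⟩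
        _ ≈⟨ ∫-scale a p _ ⟩
        _ ≈⟨ *-congˡ (∫-Δ p φ) ⟨
        _ ≈⟨ ∫-scale² a (Δ p) φ ⟨
        _ ∎
    ; Δ-* = λ p q → L².∫≈⇒≈L (Δ (p *H q)) (Δ p *² Δ q) λ φ r → begin
        _ ≈⟨ ∫-Δ (p *H q) φ ⟩
        _ ≈⟨ ∫-*H p q _ ⟩
        _ ≈⟨ ∫-cong p (λ M → ∫-cong q λ N → ∫Δ-++ M N (λ A B → φ (A , B))) ⟩
        _ ≈⟨ ∫-cong p (λ M → ∫-swap q (ΔMono M) _) ⟩
        _ ≈⟨ ∫-cong p (λ M → ∫-cong (ΔMono M) λ _ → ∫-Δ q _) ⟨
        _ ≈⟨ ∫-Δ p _ ⟨
        _ ≈⟨ ∫-*² (Δ p) (Δ q) φ ⟨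
        _ ∎
    ; Δ-1 = L².∫≈⇒≈L (Δ 1H) 1² λ φ r → trans (∫-Δ 1H φ) (∫-pure [] (λ M → ∫ (ΔMono M) φ))
    ; ε-cong = λ p q e → begin
        _ ≈⟨ ε≈∫ p ⟩
        _ ≈⟨ ∫-cong-≈H {p} {q} e εMono-respects ⟩
        _ ≈⟨ ε≈∫ q ⟨
        _ ∎
    ; ε-+ = λ p q → begin
        _ ≈⟨ ε≈∫ (p +H q) ⟩
        _ ≈⟨ ∫-++ p q εMono ⟩
        _ ≈⟨ +-cong (ε≈∫ p) (ε≈∫ q) ⟨
        _ ∎
    ; ε-scale = λ a p → begin
        _ ≈⟨ ε≈∫ (H.scale a p) ⟩
        _ ≈⟨ ∫-scale a p εMono ⟩
        _ ≈⟨ *-congˡ (ε≈∫ p) ⟨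
        _ ∎
    ; ε-* = λ p q → begin
        _ ≈⟨ ε≈∫ (p *H q) ⟩
        _ ≈⟨ ∫-*H p q εMono ⟩
        _ ≈⟨ ∫-cong p (λ M → trans (∫-cong q λ N → εMono-++ M N) (trans (∫-*ˡ q (εMono M) εMono) (*-comm _ _))) ⟩
        _ ≈⟨ ∫-*ˡ p (∫ q εMono) εMono ⟩
        _ ≈⟨ *-comm _ _ ⟩
        _ ≈⟨ *-cong (ε≈∫ p) (ε≈∫ q) ⟨
        _ ∎
    ; ε-1 = ∫-pure [] εMono
    ; coassoc = λ p → L³.∫≈⇒≈L (Δ⊗id (Δ p)) (id⊗Δ (Δ p)) λ φ r → begin
        _ ≈⟨ ∫-Δ⊗id (Δ p) φ ⟩
        _ ≈⟨ ∫-Δ p _ ⟩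
        _ ≈⟨ ∫-cong p (λ M → ∫Δ-coassoc M (λ A B C → φ (A , B , C)) (λ s s′ s″ → r (s , s′ , s″))) ⟩
        _ ≈⟨ ∫-Δ p _ ⟨
        _ ≈⟨ ∫-id⊗Δ (Δ p) φ ⟨
        _ ∎
    ; counitˡ = λ p → L¹.∫≈⇒≈L (ε⊗id (Δ p)) p λ φ r →
        trans (∫-ε⊗id (Δ p) φ) (trans (∫-Δ p _) (∫-cong p λ M → ∫Δ-counitˡ M φ))
    ; counitʳ = λ p → L¹.∫≈⇒≈L (id⊗ε (Δ p)) p λ φ r →
        trans (∫-id⊗ε (Δ p) φ) (trans (∫-Δ p _) (∫-cong p λ M → ∫Δ-counitʳ M φ))
    ; deg-1 = ≡.refl
    ; deg-* = degMono-++
    ; Δ-graded = ΔMono-graded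
    ; ε-graded = λ { [] d → ⊥-elim (d ≡.refl) ; (t ∷ M) d → refl }
    ; connected = λ { [] d → ≡.refl
                    ; (t ∷ M) d → case ≡.subst (1 ≤_) d (degMono≥1 (t ∷ M) (s≤s z≤n)) of λ () }
    ; antipode = antipode , antipode-linear , antipodeˡ , antipodeʳ
    }

theorem3p6 : ∀ {c ℓ} (F : CharZeroField c ℓ) (m : ℕ) → 1 ≤ m
    → RCTHopf.IsConnectedGradedCommHopf F m
theorem3p6 F m _ = HopfAlgebra.hopf F m
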